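{- Let $G$ be a connected graph of order $n$, and let $m(-1)$ denote the multiplicity of $-1$ as an eigenvalue of the eccentricity matrix $\mathcal{A}(G)$. Let $\mathcal{G}_1=\{K_{n-4}\vee 4K_1,\ K_{n-4}\vee(2K_1\cup K_2),\ K_{n-4}\vee(P_3\cup K_1),\ K_{n-4}\vee 2K_2,\ K_{n-4}\vee P_4,\ K_{n-4}\vee(K_3\cup K_1),\ K_{n-4}\vee C_4\}$. Then: (i) $m(-1)=n-1$ if and only if $G\cong K_n$; (ii) $m(-1)\neq n-2$; (iii) for $n\geq 4$, $m(-1)=n-3$ if and only if $G\in\{K_{n-2}\vee 2K_1,\ P_4\}$; (iv) for $n\geq 9$, $m(-1)=n-4$ if and only if $G\in\{K_{n-3}\vee(K_2\cup K_1),\ K_{n-3}\vee 3K_1\}$; (v) for $n\geq 16$, $m(-1)=n-5$ if and only if $G\in\mathcal{G}_1\cup\{K_{n-5}\vee C_5,\ K_{n-5}\vee(K_1\cup P_4),\ K_{n-5}\vee H_1\}$, where $H_1$ is the bull graph.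
   Context: All graphs are simple. For a connected graph $G$, $d(u,v)$ is the distance between $u,v$ and the eccentricity of $v$ is $\varepsilon(v)=\max_{u\in V(G)} d(u,v)$. The eccentricity matrix $\mathcal{A}(G)$ is the matrix indexed by $V(G)$ whose $(u,v)$-entry is $d(u,v)$ if $d(u,v)=\min\{\varepsilon(u),\varepsilon(v)\}$ and $0$ otherwise. $K_n,P_n,C_n$ denote the complete graph, path and cycle on $n$ vertices; $kK_1$ (resp. $2K_2$) is the disjoint union of $k$ copies of $K_1$ (resp. two copies of $K_2$); $G\cup H$ is disjoint union; $G\vee H$ is the join (disjoint union plus all edges between $G$ and $H$). The bull graph $H_1$ has vertices $a,b,c,x,y$ and edges $ab,bc,ca,xa,yb$ (a triangle with pendant vertices attached to two distinct triangle vertices). -}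

module Defs where

open import Data.Bool using (Bool; true; false; _∧_; _∨_; not; if_then_else_)
open import Data.Bool.Properties using (∨-comm)
open import Data.Nat using (ℕ; zero; suc; _+_; _⊔_; _⊓_; _≡ᵇ_)
open import Data.Fin using (Fin; zero; suc; toℕ; splitAt; _≟_)
open import Data.Sum using (inj₁; inj₂)
open import Data.Integer using (+_)
open import Data.Rational using (ℚ; 0ℚ; 1ℚ; _/_) renaming (_+_ to _+ℚ_; _*_ to _*ℚ_)
open import Data.Product using (Σ; _×_; ∃)
open import Relation.Nullary using (¬_; yes; no)
open import Relation.Nullary.Decidable using (⌊_⌋)
open import Relation.Binary.PropositionalEquality using (_≡_; refl; cong)
open import Function.Bundles using (_↔_; Inverse)

record Graph (n : ℕ) : Set where
  field
    adj    : Fin n → Fin n → Bool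
    sym    : ∀ u v → adj u v ≡ adj v u
    irrefl : ∀ u → adj u u ≡ false
open Graph public

fromRel : ∀ {n} → (Fin n → Fin n → Bool) → Graph n
fromRel r = record
  { adj    = λ u v → not ⌊ u ≟ v ⌋ ∧ (r u v ∨ r v u)
  ; sym    = symP
  ; irrefl = irr }
  where
  symP : ∀ u v → (not ⌊ u ≟ v ⌋ ∧ (r u v ∨ r v u)) ≡ (not ⌊ v ≟ u ⌋ ∧ (r v u ∨ r u v))
  symP u v with u ≟ v | v ≟ u
  ... | yes _ | yes _ = refl
  ... | no _  | no _  = ∨-comm (r u v) (r v u)
  ... | yes refl | no p with p refl
  ... | ()
  symP u v | no p | yes refl with p refl
  ... | ()
  irr : ∀ u → (not ⌊ u ≟ u ⌋ ∧ (r u u ∨ r u u)) ≡ false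
  irr u with u ≟ u
  ... | yes _ = refl
  ... | no p with p refl
  ... | ()

-- graph isomorphism (between graphs on possibly differently written orders)
_≅_ : ∀ {n m} → Graph n → Graph m → Set
_≅_ {n} {m} G H = Σ (Fin n ↔ Fin m) λ f →
  ∀ u v → adj G u v ≡ adj H (Inverse.to f u) (Inverse.to f v)

K : (k : ℕ) → Graph k
K k = fromRel (λ _ _ → true)

E : (k : ℕ) → Graph k
E k = fromRel (λ _ _ → false)

P : (k : ℕ) → Graph k
P k = fromRel (λ u v → toℕ v ≡ᵇ suc (toℕ u))

C : (k : ℕ) → Graph k
C zero    = fromRel (λ _ _ → false)
C (suc k) = fromRel (λ u v → (toℕ v ≡ᵇ suc (toℕ u)) ∨ ((toℕ u ≡ᵇ 0) ∧ (toℕ v ≡ᵇ k)))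

_∪_ : ∀ {a b} → Graph a → Graph b → Graph (a + b)
_∪_ {a} G H = fromRel r
  where
  r : Fin _ → Fin _ → Bool
  r u v with splitAt a u | splitAt a v
  ... | inj₁ i | inj₁ j = adj G i j
  ... | inj₂ i | inj₂ j = adj H i j
  ... | _      | _      = false

_∨G_ : ∀ {a b} → Graph a → Graph b → Graph (a + b)
_∨G_ {a} G H = fromRel r
  where
  r : Fin _ → Fin _ → Bool
  r u v with splitAt a u | splitAt a v
  ... | inj₁ i | inj₁ j = adj G i j
  ... | inj₂ i | inj₂ j = adj H i j
  ... | _      | _      = true

bullRel : Fin 5 → Fin 5 → Bool
bullRel u v = edge (toℕ u) (toℕ v)
  where
  edge : ℕ → ℕ → Bool
  edge 0 1 = true
  edge 1 2 = true
  edge 2 0 = true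
  edge 3 0 = true
  edge 4 1 = true
  edge _ _ = false

Bull : Graph 5
Bull = fromRel bullRel

anyFin : ∀ {n} → (Fin n → Bool) → Bool
anyFin {zero}  f = false
anyFin {suc n} f = f zero ∨ anyFin (λ i → f (suc i))

maxFin : ∀ {n} → (Fin n → ℕ) → ℕ
maxFin {zero}  f = 0
maxFin {suc n} f = f zero ⊔ maxFin (λ i → f (suc i))

within : ∀ {n} → Graph n → ℕ → Fin n → Fin n → Bool
within G zero    u v = ⌊ u ≟ v ⌋
within G (suc k) u v = within G k u v ∨ anyFin (λ w → within G k u w ∧ adj G w v)

Connected : ∀ {n} → Graph n → Set
Connected {n} G = ∀ u v → within G n u v ≡ true

search : ℕ → (ℕ → Bool) → ℕ → ℕ
search zero       p i = i
search (suc fuel) p i = if p i then i else search fuel p (suc i)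

-- distance d(u,v) (exact for connected graphs)
dist : ∀ {n} → Graph n → Fin n → Fin n → ℕ
dist {n} G u v = search (suc n) (λ i → within G i u v) 0

ecc : ∀ {n} → Graph n → Fin n → ℕ
ecc G v = maxFin (λ u → dist G u v)

eccEntry : ∀ {n} → Graph n → Fin n → Fin n → ℕ
eccEntry G u v = if dist G u v ≡ᵇ (ecc G u ⊓ ecc G v) then dist G u v else 0

eccMatrix : ∀ {n} → Graph n → Fin n → Fin n → ℚ
eccMatrix G u v = (+ eccEntry G u v) / 1

sumFin : ∀ {n} → (Fin n → ℚ) → ℚ
sumFin {zero}  f = 0ℚ
sumFin {suc n} f = f zero +ℚ sumFin (λ i → f (suc i))

IsEigenvector : ∀ {n} → (Fin n → Fin n → ℚ) → ℚ → (Fin n → ℚ) → Set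
IsEigenvector A μ x = ∀ i → sumFin (λ j → A i j *ℚ x j) ≡ μ *ℚ x i

LinIndep : ∀ {n k} → (Fin k → Fin n → ℚ) → Set
LinIndep vs = ∀ (c : Fin _ → ℚ) →
  (∀ j → sumFin (λ i → c i *ℚ vs i j) ≡ 0ℚ) → ∀ i → c i ≡ 0ℚ

HasEigMult : ∀ {n} → (Fin n → Fin n → ℚ) → ℚ → ℕ → Set
HasEigMult {n} A μ k =
  (Σ (Fin k → Fin n → ℚ) λ vs → (∀ i → IsEigenvector A μ (vs i)) × LinIndep vs)
  × (∀ (vs : Fin (suc k) → Fin n → ℚ) → (∀ i → IsEigenvector A μ (vs i)) → ¬ LinIndep vs)

{-# OPTIONS --safe #-}
-- The corank of A + I is r = n − m(−1), and A + I has the entries 0, 1 and min(ε(u), ε(v)).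
-- If some vertex is universal, G = K_s ∨ H where H has no universal vertex, and A + I is constant on K_s; its rank is
-- that of I + 2B (B the complement of H), bordered by ones. Since I + 2B is nonsingular modulo 2, r is |H| or |H| + 1,
-- which leaves finitely many H. If no vertex is universal, all eccentricities are at least 2, and two bounds apply:
-- the vertices whose eccentricity is divisible by k ≥ 2 span a principal submatrix congruent to I modulo k, so there
-- are at most r of them; and a geodesic of length e gives a star-shaped nonsingular principal submatrix of order e, so
-- ε ≤ r. For r = 5, 4 these give n ≤ 15 and n ≤ 8, and r = 3 forces P_4 by inspection of 4 × 4 minors.
module Submission where

open import Defs hiding (sym)
open import Algebra.Bundles using (CommutativeRing)
import Algebra.Properties.Semiring.Sum as SemiringSum
open import Data.Bool using (Bool; true; false; _∧_; _∨_; _xor_; not; if_then_else_; T)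
open import Data.Bool.ListAction using (any)
open import Data.Bool.Properties using (∨-idem)
open import Data.Fin as Fin using (Fin; zero; suc; toℕ; _≟_; splitAt; punchIn; inject≤)
import Data.Fin.Permutation as Permutation
import Data.Fin.Properties as Fin
open import Data.Fin.Properties using (+↔⊎)
open import Data.Integer as ℤ using (ℤ; +_; 0ℤ; 1ℤ)
import Data.Integer.Properties as ℤ
import Data.Integer.Solver as ℤSolver
open import Data.List as List using (List; []; _∷_; _++_)
open import Data.List.Relation.Unary.All as All using (All; []; _∷_)
import Data.List.Relation.Unary.All.Properties as All
open import Data.List.Relation.Unary.Any as Any using (Any; here; there)
open import Data.Maybe using (Maybe; just; nothing)
open import Data.Nat as ℕ using (ℕ; zero; suc; _+_; _∸_; _≤_; _<_; z≤n; s≤s)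
open import Data.Nat.Divisibility using (_∣_; _∣?_; divides)
import Data.Nat.Properties as ℕ
open import Data.Product using (Σ; Σ-syntax; ∃; _×_; _,_; proj₁; proj₂)
open import Data.Rational as ℚ using (ℚ; 0ℚ; 1ℚ; -_)
import Data.Rational.Properties as ℚ
open import Data.Rational.Solver using () renaming (module +-*-Solver to ℚ-Solver)
open import Data.Rational.Unnormalised as ℚᵘ using (mkℚᵘ; *≡*)
import Data.Rational.Unnormalised.Properties as ℚᵘ
open import Data.Sum using (_⊎_; inj₁; inj₂; [_,_]′)
open import Data.Sum.Function.Propositional using (_⊎-↔_)
open import Data.Sum.Properties using (inj₁-injective; inj₂-injective)
open import Data.Unit using (⊤; tt)
open import Data.Vec as Vec using (Vec; []; _∷_; lookup)
open import Data.Vec.Properties using (lookup∘tabulate)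
open import Function using (_∘_; _⟨_⟩_)
open import Function.Bundles using (_⇔_; _↔_; Inverse; mk⇔; mk↔ₛ′)
open import Function.Construct.Composition using (_↔-∘_)
open import Function.Construct.Identity using (↔-id)
open import Function.Construct.Symmetry using (↔-sym)
open import Relation.Binary.Definitions using (Tri; tri<; tri≈; tri>)
open import Relation.Binary.PropositionalEquality as ≡ using (_≡_; _≢_; refl; cong; cong₂; subst; subst₂; module ≡-Reasoning)
open import Relation.Nullary using (¬_; Dec; yes; no; contradiction)
open import Relation.Nullary.Decidable using (⌊_⌋)

-- Linear algebra over ℚ

-- Neither rank nor determinant is defined; m is squeezed from two sides. A principal submatrix of
-- order k with trivial kernel gives m + k ≤ n, and k explicit null vectors in diagonal position
-- give k ≤ m. Congruence to I modulo k and the star shape are the only general sources of trivial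
-- kernels; all other matrices have fixed size and are settled by evaluating an integer elimination.
-- The congruence holds because a nonzero entry of A is the smaller of two eccentricities, so k
-- divides it once k divides both. With eccentricities confined to 2, ..., r, the primes up to r
-- cover all vertices: 2, 3, 5 for r = 5 and 2, 3 for r = 4, hence 15 = 3 · 5 and 8 = 2 · 4. For r =
-- 3 this count would give only n ≤ 6, while the claim starts at n = 4, so there the minors have to
-- be examined. Modulo 2 the bordered matrix has determinant 1 - |H|, so it can be singular only for
-- odd |H|. This is why H of order 4 always has r = 5, and why the exceptional graphs C_5, K_1 ∪ P_4
-- and the bull have order 5.

module ∑ℚ = SemiringSum (CommutativeRing.semiring ℚ.+-*-commutativeRing)
module ∑ℤ = SemiringSum (CommutativeRing.semiring ℤ.+-*-commutativeRing)

sumFin≡∑ : ∀ {n} (f : Fin n → ℚ) → sumFin f ≡ ∑ℚ.sum f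
sumFin≡∑ {zero}  f = refl
sumFin≡∑ {suc n} f = cong (f zero ℚ.+_) (sumFin≡∑ (f ∘ suc))

∑-zero : ∀ {n} {f : Fin n → ℚ} → (∀ i → f i ≡ 0ℚ) → ∑ℚ.sum f ≡ 0ℚ
∑-zero {n} f≡0 = ≡.trans (∑ℚ.sum-cong-≗ f≡0) (∑ℚ.sum-replicate-zero n)

∑-++ : ∀ m {k} (f : Fin (m + k) → ℚ) →
  ∑ℚ.sum f ≡ ∑ℚ.sum (λ i → f (i Fin.↑ˡ k)) ℚ.+ ∑ℚ.sum (λ j → f (m Fin.↑ʳ j))
∑-++ zero    f = ≡.sym (ℚ.+-identityˡ _)
∑-++ (suc m) f = ≡.trans (cong (f zero ℚ.+_) (∑-++ m (f ∘ suc))) (≡.sym (ℚ.+-assoc (f zero) _ _))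

ι : ℤ → ℚ
ι i = i ℚ./ 1

toℚᵘ-ι : ∀ i → ℚ.toℚᵘ (ι i) ℚᵘ.≃ mkℚᵘ i 0
toℚᵘ-ι i = ℚ.toℚᵘ-fromℚᵘ (mkℚᵘ i 0)

ι-+ : ∀ a b → ι (a ℤ.+ b) ≡ ι a ℚ.+ ι b
ι-+ a b = ℚ.toℚᵘ-injective (ℚᵘ.≃-trans (toℚᵘ-ι (a ℤ.+ b))
  (ℚᵘ.≃-trans (*≡* (solve 2 (λ a b → (a :+ b) :* con 1ℤ := (a :* con 1ℤ :+ b :* con 1ℤ) :* con 1ℤ) refl a b))
  (ℚᵘ.≃-sym (ℚᵘ.≃-trans (ℚ.toℚᵘ-homo-+ (ι a) (ι b)) (ℚᵘ.+-cong (toℚᵘ-ι a) (toℚᵘ-ι b))))))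
  where open ℤSolver.+-*-Solver

ι-* : ∀ a b → ι (a ℤ.* b) ≡ ι a ℚ.* ι b
ι-* a b = ℚ.toℚᵘ-injective (ℚᵘ.≃-trans (toℚᵘ-ι (a ℤ.* b))
  (ℚᵘ.≃-sym (ℚᵘ.≃-trans (ℚ.toℚᵘ-homo-* (ι a) (ι b)) (ℚᵘ.*-cong (toℚᵘ-ι a) (toℚᵘ-ι b)))))

ι-injective : ∀ {a b} → ι a ≡ ι b → a ≡ b
ι-injective {a} {b} e
  with *≡* e′ ← ℚᵘ.≃-trans (ℚᵘ.≃-sym (toℚᵘ-ι a)) (ℚᵘ.≃-trans (ℚ.toℚᵘ-cong e) (toℚᵘ-ι b))
  = ≡.trans (≡.sym (ℤ.*-identityʳ a)) (≡.trans e′ (ℤ.*-identityʳ b))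

ι-∑ : ∀ {n} (f : Fin n → ℤ) → ι (∑ℤ.sum f) ≡ ∑ℚ.sum (ι ∘ f)
ι-∑ {zero}  f = refl
ι-∑ {suc n} f = ≡.trans (ι-+ (f zero) _) (cong (ι (f zero) ℚ.+_) (ι-∑ (f ∘ suc)))

p≢0∧p*q≡0⇒q≡0 : ∀ {p q} → p ≢ 0ℚ → p ℚ.* q ≡ 0ℚ → q ≡ 0ℚ
p≢0∧p*q≡0⇒q≡0 {p} {q} p≢0 pq≡0 = begin
  q                       ≡⟨ ≡.sym (ℚ.*-identityˡ q) ⟩
  1ℚ ℚ.* q                ≡⟨ cong (ℚ._* q) (≡.sym (ℚ.*-inverseˡ p)) ⟩
  ((ℚ.1/ p) ℚ.* p) ℚ.* q  ≡⟨ ℚ.*-assoc (ℚ.1/ p) p q ⟩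
  (ℚ.1/ p) ℚ.* (p ℚ.* q)  ≡⟨ cong ((ℚ.1/ p) ℚ.*_) pq≡0 ⟩
  (ℚ.1/ p) ℚ.* 0ℚ         ≡⟨ ℚ.*-zeroʳ (ℚ.1/ p) ⟩
  0ℚ                      ∎
  where
  open ≡-Reasoning
  instance _ = ℚ.≢-nonZero p≢0

Dependent : ∀ {n N} → (Fin N → Fin n → ℚ) → Set
Dependent {N = N} A = Σ[ c ∈ (Fin N → ℚ) ] (∃ λ i → c i ≢ 0ℚ) × (∀ j → ∑ℚ.sum (λ i → c i ℚ.* A i j) ≡ 0ℚ)

-- Gaussian elimination without division: A p clears the first coordinate of the other vectors.
dependent : ∀ {n N} → n < N → (A : Fin N → Fin n → ℚ) → Dependent A
dependent {zero}  {suc N} _         A = (λ _ → 1ℚ) , (zero , λ ()) , λ ()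
dependent {suc n} {suc N} (s≤s n<N) A with Fin.all? (λ i → A i zero ℚ.≟ 0ℚ)
... | yes A₀≡0 = c , c≢0 , λ
  { zero    → ∑-zero (λ i → ≡.trans (cong (c i ℚ.*_) (A₀≡0 i)) (ℚ.*-zeroʳ (c i)))
  ; (suc j) → cA≡0 j }
  where
  dep = dependent {n} (ℕ.m≤n⇒m≤1+n n<N) (λ i j → A i (suc j))
  c = proj₁ dep
  c≢0 = proj₁ (proj₂ dep)
  cA≡0 = proj₂ (proj₂ dep)
... | no A₀≢0 with Fin.¬∀⟶∃¬ _ _ (λ i → A i zero ℚ.≟ 0ℚ) A₀≢0
... | p , a≢0 = c , (punchIn p (proj₁ c′≢0) , cᵢ≢0) , cA≡0
  where
  open ≡-Reasoning
  a = A p zero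
  A′ : Fin N → Fin (suc n) → ℚ
  A′ i = A (punchIn p i)
  B : Fin N → Fin (suc n) → ℚ
  B i j = a ℚ.* A′ i j ℚ.+ - (A′ i zero ℚ.* A p j)
  dep = dependent n<N (λ i j → B i (suc j))
  c′ = proj₁ dep
  c′≢0 = proj₁ (proj₂ dep)
  s = ∑ℚ.sum (λ i → c′ i ℚ.* A′ i zero)
  c : Fin (suc N) → ℚ
  -- Since ∑ c′ᵢ Bᵢ = a ∑ c′ᵢ A′ᵢ - s A p, a relation among the `B i` becomes one among the original
  -- vectors with coefficients a c′ᵢ, and -s at the pivot.
  c i with i ≟ p
  ... | yes _  = - s
  ... | no i≢p = a ℚ.* c′ (Fin.punchOut (i≢p ∘ ≡.sym))
  c-p : c p ≡ - s
  c-p with p ≟ p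
  ... | yes _  = refl
  ... | no p≢p = contradiction refl p≢p
  c-punchIn : ∀ i → c (punchIn p i) ≡ a ℚ.* c′ i
  c-punchIn i with punchIn p i ≟ p
  ... | yes e = contradiction e (Fin.punchInᵢ≢i p i)
  ... | no _  = cong (λ k → a ℚ.* c′ k) (≡.trans (Fin.punchOut-cong p refl) (Fin.punchOut-punchIn p))
  cᵢ≢0 : c (punchIn p (proj₁ c′≢0)) ≢ 0ℚ
  cᵢ≢0 e = proj₂ c′≢0 (p≢0∧p*q≡0⇒q≡0 a≢0 (≡.trans (≡.sym (c-punchIn _)) e))
  B-zero : ∀ i → B i zero ≡ 0ℚ
  B-zero i = solve 2 (λ a b → a :* b :+ :- (b :* a) := con 0ℚ) refl a (A′ i zero)
    where open ℚ-Solver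
  c′B≡0 : ∀ j → ∑ℚ.sum (λ i → c′ i ℚ.* B i j) ≡ 0ℚ
  c′B≡0 zero    = ∑-zero (λ i → ≡.trans (cong (c′ i ℚ.*_) (B-zero i)) (ℚ.*-zeroʳ (c′ i)))
  c′B≡0 (suc j) = proj₂ (proj₂ dep) j
  rearrange : ∀ c a x b y → a ℚ.* c ℚ.* x ≡ c ℚ.* (a ℚ.* x ℚ.+ - (b ℚ.* y)) ℚ.+ c ℚ.* b ℚ.* y
  rearrange = solve 5 (λ c a x b y → a :* c :* x := c :* (a :* x :+ :- (b :* y)) :+ c :* b :* y) refl
    where open ℚ-Solver
  cancel : ∀ s y → - s ℚ.* y ℚ.+ (0ℚ ℚ.+ s ℚ.* y) ≡ 0ℚ
  cancel = solve 2 (λ s y → :- s :* y :+ (con 0ℚ :+ s :* y) := con 0ℚ) refl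
    where open ℚ-Solver
  cA≡0 : ∀ j → ∑ℚ.sum (λ i → c i ℚ.* A i j) ≡ 0ℚ
  cA≡0 j = begin
    ∑ℚ.sum (λ i → c i ℚ.* A i j)
      ≡⟨ ∑ℚ.sum-remove {i = p} (λ i → c i ℚ.* A i j) ⟩
    c p ℚ.* A p j ℚ.+ ∑ℚ.sum (λ i → c (punchIn p i) ℚ.* A′ i j)
      ≡⟨ cong₂ ℚ._+_ (cong (ℚ._* A p j) c-p) (∑ℚ.sum-cong-≗ (λ i →
           ≡.trans (cong (ℚ._* A′ i j) (c-punchIn i)) (rearrange (c′ i) a (A′ i j) (A′ i zero) (A p j)))) ⟩
    - s ℚ.* A p j ℚ.+ ∑ℚ.sum (λ i → c′ i ℚ.* B i j ℚ.+ c′ i ℚ.* A′ i zero ℚ.* A p j)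
      ≡⟨ cong (- s ℚ.* A p j ℚ.+_) (∑ℚ.∑-distrib-+ (λ i → c′ i ℚ.* B i j) _) ⟩
    - s ℚ.* A p j ℚ.+ (∑ℚ.sum (λ i → c′ i ℚ.* B i j) ℚ.+ ∑ℚ.sum (λ i → c′ i ℚ.* A′ i zero ℚ.* A p j))
      ≡⟨ cong (- s ℚ.* A p j ℚ.+_) (cong₂ ℚ._+_ (c′B≡0 j) (≡.sym (∑ℚ.*-distribʳ-sum (A p j) (λ i → c′ i ℚ.* A′ i zero)))) ⟩
    - s ℚ.* A p j ℚ.+ (0ℚ ℚ.+ s ℚ.* A p j)
      ≡⟨ cancel s (A p j) ⟩
    0ℚ ∎

-- Bridges the two rings: eigenvectors are rational, whereas the divisibility argument and the
-- elimination work on integer vectors.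
clear-denominators : ∀ {k} (y : Fin k → ℚ) →
  Σ[ D ∈ ℤ ] Σ[ p ∈ (Fin k → ℤ) ] ι D ≢ 0ℚ × (∀ i → ι D ℚ.* y i ≡ ι (p i))
clear-denominators {zero}  y = 1ℤ , (λ ()) , (λ ()) , λ ()
clear-denominators {suc k} y with clear-denominators (y ∘ suc)
... | D , p , D≢0 , Dy≡p = D ℤ.* d , p′ , Dd≢0 , λ
  { zero    → ≡.trans (cong (ℚ._* y zero) (ι-* D d)) (≡.trans (ℚ.*-assoc (ι D) (ι d) (y zero))
                (≡.trans (cong (ι D ℚ.*_) dy≡) (≡.sym (ι-* D (ℚ.↥ y zero)))))
  ; (suc i) → ≡.trans (cong (ℚ._* y (suc i)) (≡.trans (cong ι (ℤ.*-comm D d)) (ι-* d D)))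
                (≡.trans (ℚ.*-assoc (ι d) (ι D) (y (suc i)))
                (≡.trans (cong (ι d ℚ.*_) (Dy≡p i)) (≡.sym (ι-* d (p i))))) }
  where
  d = ℚ.↧ y zero
  p′ : Fin (suc k) → ℤ
  p′ zero    = D ℤ.* ℚ.↥ y zero
  p′ (suc i) = d ℤ.* p i
  Dd≢0 : ι (D ℤ.* d) ≢ 0ℚ
  Dd≢0 e with ℤ.i*j≡0⇒i≡0∨j≡0 D (ι-injective {D ℤ.* d} {0ℤ} e)
  ... | inj₁ D≡0 = D≢0 (cong ι D≡0)
  ... | inj₂ ()
  dy≡ : ι d ℚ.* y zero ≡ ι (ℚ.↥ y zero)
  dy≡ = ℚ.toℚᵘ-injective (ℚᵘ.≃-trans (ℚ.toℚᵘ-homo-* (ι d) (y zero))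
    (ℚᵘ.≃-trans (ℚᵘ.*-cong (toℚᵘ-ι d) (ℚᵘ.≃-refl {ℚ.toℚᵘ (y zero)}))
    (ℚᵘ.≃-trans (eq (y zero)) (ℚᵘ.≃-sym (toℚᵘ-ι (ℚ.↥ y zero))))))
    where
    eq : ∀ q → mkℚᵘ (ℚ.↧ q) 0 ℚᵘ.* ℚ.toℚᵘ q ℚᵘ.≃ mkℚᵘ (ℚ.↥ q) 0
    eq (ℚ.mkℚ n d _) = *≡* (solve 2 (λ n d → d :* n :* con 1ℤ := n :* (con 1ℤ :* d)) refl n (+ suc d))
      where open ℤSolver.+-*-Solver

-- Unit vectors, null vectors and integer kernels

δ : ∀ {n} → Fin n → Fin n → ℤ
δ zero    zero    = 1ℤ
δ zero    (suc j) = 0ℤ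
δ (suc i) zero    = 0ℤ
δ (suc i) (suc j) = δ i j

δ-refl : ∀ {n} (i : Fin n) → δ i i ≡ 1ℤ
δ-refl zero    = refl
δ-refl (suc i) = δ-refl i

δ-≢ : ∀ {n} {i j : Fin n} → i ≢ j → δ i j ≡ 0ℤ
δ-≢ {i = zero}  {zero}  i≢j = contradiction refl i≢j
δ-≢ {i = zero}  {suc j} i≢j = refl
δ-≢ {i = suc i} {zero}  i≢j = refl
δ-≢ {i = suc i} {suc j} i≢j = δ-≢ (i≢j ∘ cong suc)

δ-sym : ∀ {n} (i j : Fin n) → δ i j ≡ δ j i
δ-sym zero    zero    = refl
δ-sym zero    (suc j) = refl
δ-sym (suc i) zero    = refl
δ-sym (suc i) (suc j) = δ-sym i j

∑-δ : ∀ {n} (g : Fin n → ℚ) a → ∑ℚ.sum (λ j → g j ℚ.* ι (δ a j)) ≡ g a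
∑-δ g zero    = ≡.trans (cong₂ ℚ._+_ (ℚ.*-identityʳ (g zero)) (∑-zero (λ j → ℚ.*-zeroʳ (g (suc j)))))
  (ℚ.+-identityʳ (g zero))
∑-δ g (suc a) = ≡.trans (cong₂ ℚ._+_ (ℚ.*-zeroʳ (g zero)) (∑-δ (g ∘ suc) a)) (ℚ.+-identityˡ _)

comb : ∀ {n k} → (Fin k → Fin n → ℚ) → (Fin k → ℚ) → Fin n → ℚ
comb vs c j = ∑ℚ.sum (λ i → c i ℚ.* vs i j)

unitVectors : ∀ {n k} → (Fin k → Fin n) → Fin k → Fin n → ℚ
unitVectors f i j = ι (δ (f i) j)

∑-comb : ∀ {n k} (a : Fin n → ℚ) (vs : Fin k → Fin n → ℚ) c →
  ∑ℚ.sum (λ j → a j ℚ.* comb vs c j) ≡ ∑ℚ.sum (λ i → c i ℚ.* ∑ℚ.sum (λ j → a j ℚ.* vs i j))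
∑-comb a vs c = begin
  ∑ℚ.sum (λ j → a j ℚ.* comb vs c j)
    ≡⟨ ∑ℚ.sum-cong-≗ (λ j → ∑ℚ.*-distribˡ-sum (a j) (λ i → c i ℚ.* vs i j)) ⟩
  ∑ℚ.sum (λ j → ∑ℚ.sum (λ i → a j ℚ.* (c i ℚ.* vs i j)))
    ≡⟨ ∑ℚ.∑-comm (λ j i → a j ℚ.* (c i ℚ.* vs i j)) ⟩
  ∑ℚ.sum (λ i → ∑ℚ.sum (λ j → a j ℚ.* (c i ℚ.* vs i j)))
    ≡⟨ ∑ℚ.sum-cong-≗ (λ i → ≡.trans (∑ℚ.sum-cong-≗ (λ j → swap (a j) (c i) (vs i j)))
         (≡.sym (∑ℚ.*-distribˡ-sum (c i) (λ j → a j ℚ.* vs i j)))) ⟩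
  ∑ℚ.sum (λ i → c i ℚ.* ∑ℚ.sum (λ j → a j ℚ.* vs i j)) ∎
  where
  open ≡-Reasoning
  swap : ∀ a c v → a ℚ.* (c ℚ.* v) ≡ c ℚ.* (a ℚ.* v)
  swap = solve 3 (λ a c v → a :* (c :* v) := c :* (a :* v)) refl
    where open ℚ-Solver

Null : ∀ {n} → (Fin n → Fin n → ℤ) → (Fin n → ℚ) → Set
Null N x = ∀ i → ∑ℚ.sum (λ j → ι (N i j) ℚ.* x j) ≡ 0ℚ

TrivialKernel : ∀ {l k} → (Fin l → Fin k → ℤ) → Set
TrivialKernel {k = k} N = ∀ (p : Fin k → ℤ) → (∀ i → ∑ℤ.sum (λ j → N i j ℤ.* p j) ≡ 0ℤ) → ∀ j → p j ≡ 0ℤ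

TrivialKernel-cong : ∀ {l k} {N N′ : Fin l → Fin k → ℤ} → (∀ i j → N i j ≡ N′ i j) →
  TrivialKernel N → TrivialKernel N′
TrivialKernel-cong N≗N′ triv p N′p≡0 =
  triv p (λ i → ≡.trans (∑ℤ.sum-cong-≗ (λ j → cong (ℤ._* p j) (N≗N′ i j))) (N′p≡0 i))

Null-comb : ∀ {n k} {N : Fin n → Fin n → ℤ} {vs : Fin k → Fin n → ℚ} c → (∀ i → Null N (vs i)) → Null N (comb vs c)
Null-comb {N = N} {vs} c null i = ≡.trans (∑-comb (ι ∘ N i) vs c)
  (∑-zero (λ k → ≡.trans (cong (c k ℚ.*_) (null k i)) (ℚ.*-zeroʳ (c k))))

∑-comb-unit : ∀ {n k} (a : Fin n → ℚ) (f : Fin k → Fin n) y →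
  ∑ℚ.sum (λ j → a j ℚ.* comb (unitVectors f) y j) ≡ ∑ℚ.sum (λ i → y i ℚ.* a (f i))
∑-comb-unit a f y = ≡.trans (∑-comb a (unitVectors f) y) (∑ℚ.sum-cong-≗ (λ i → cong (y i ℚ.*_) (∑-δ a (f i))))

Null-unit : ∀ {n k} {N : Fin n → Fin n → ℤ} (f : Fin k → Fin n) (z : Fin k → ℤ) →
  (∀ i → ∑ℤ.sum (λ j → z j ℤ.* N i (f j)) ≡ 0ℤ) → Null N (comb (unitVectors f) (ι ∘ z))
Null-unit {N = N} f z Nz≡0 i = begin
  ∑ℚ.sum (λ j → ι (N i j) ℚ.* comb (unitVectors f) (ι ∘ z) j) ≡⟨ ∑-comb-unit (ι ∘ N i) f (ι ∘ z) ⟩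
  ∑ℚ.sum (λ j → ι (z j) ℚ.* ι (N i (f j)))   ≡⟨ ∑ℚ.sum-cong-≗ (λ j → ≡.sym (ι-* (z j) (N i (f j)))) ⟩
  ∑ℚ.sum (λ j → ι (z j ℤ.* N i (f j)))       ≡⟨ ≡.sym (ι-∑ (λ j → z j ℤ.* N i (f j))) ⟩
  ι (∑ℤ.sum (λ j → z j ℤ.* N i (f j)))       ≡⟨ cong ι (Nz≡0 i) ⟩
  0ℚ                                         ∎
  where open ≡-Reasoning

TrivialKernel⇒ℚ : ∀ {l k} {N : Fin l → Fin k → ℤ} → TrivialKernel N →
  ∀ y → (∀ i → ∑ℚ.sum (λ j → y j ℚ.* ι (N i j)) ≡ 0ℚ) → ∀ j → y j ≡ 0ℚ
TrivialKernel⇒ℚ {N = N} triv y Ny≡0 j with clear-denominators y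
... | D , p , D≢0 , Dy≡p = p≢0∧p*q≡0⇒q≡0 D≢0 (≡.trans (Dy≡p j) (cong ι (triv p Np≡0 j)))
  where
  open ≡-Reasoning
  shuffle : ∀ N D y → N ℚ.* (D ℚ.* y) ≡ D ℚ.* (y ℚ.* N)
  shuffle = solve 3 (λ N D y → N :* (D :* y) := D :* (y :* N)) refl
    where open ℚ-Solver
  Np≡0 : ∀ i → ∑ℤ.sum (λ j → N i j ℤ.* p j) ≡ 0ℤ
  Np≡0 i = ι-injective (begin
    ι (∑ℤ.sum (λ j → N i j ℤ.* p j))               ≡⟨ ι-∑ (λ j → N i j ℤ.* p j) ⟩
    ∑ℚ.sum (λ j → ι (N i j ℤ.* p j))               ≡⟨ ∑ℚ.sum-cong-≗ (λ j → ≡.trans (ι-* (N i j) (p j))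
                                                        (≡.trans (cong (ι (N i j) ℚ.*_) (≡.sym (Dy≡p j))) (shuffle (ι (N i j)) (ι D) (y j)))) ⟩
    ∑ℚ.sum (λ j → ι D ℚ.* (y j ℚ.* ι (N i j)))     ≡⟨ ≡.sym (∑ℚ.*-distribˡ-sum (ι D) (λ j → y j ℚ.* ι (N i j))) ⟩
    ι D ℚ.* ∑ℚ.sum (λ j → y j ℚ.* ι (N i j))       ≡⟨ cong (ι D ℚ.*_) (Ny≡0 i) ⟩
    ι D ℚ.* 0ℚ                                     ≡⟨ ℚ.*-zeroʳ (ι D) ⟩
    0ℚ                                             ∎)

Indep : ∀ {n k} → (Fin k → Fin n → ℚ) → Set
Indep vs = ∀ c → (∀ j → comb vs c j ≡ 0ℚ) → ∀ i → c i ≡ 0ℚ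

-- The null vectors stay independent when the unit vectors of a principal submatrix with trivial kernel are adjoined.
nullity+rank≤ : ∀ {n m k} (N : Fin n → Fin n → ℤ) (vs : Fin m → Fin n → ℚ) → (∀ i → Null N (vs i)) → Indep vs →
  (f : Fin k → Fin n) → TrivialKernel (λ i j → N (f i) (f j)) → m + k ≤ n
nullity+rank≤ {n} {m} {k} N vs null indep f triv with (m + k) ℕ.≤? n
... | yes m+k≤n = m+k≤n
... | no m+k≰n = contradiction (c≡0 i) cᵢ≢0
  where
  open ≡-Reasoning
  A : Fin (m + k) → Fin n → ℚ
  A i = [ vs , unitVectors f ]′ (splitAt m i)
  dep = dependent (ℕ.≰⇒> m+k≰n) A
  c = proj₁ dep
  i = proj₁ (proj₁ (proj₂ dep))
  cᵢ≢0 = proj₂ (proj₁ (proj₂ dep))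
  c₁ : Fin m → ℚ
  c₁ i = c (i Fin.↑ˡ k)
  c₂ : Fin k → ℚ
  c₂ j = c (m Fin.↑ʳ j)
  sum≡0 : ∀ j → comb vs c₁ j ℚ.+ comb (unitVectors f) c₂ j ≡ 0ℚ
  sum≡0 j = ≡.trans (≡.sym (≡.trans (∑-++ m (λ i → c i ℚ.* A i j)) (cong₂ ℚ._+_
    (∑ℚ.sum-cong-≗ (λ i → cong (λ s → c₁ i ℚ.* [ vs , unitVectors f ]′ s j) (Fin.splitAt-↑ˡ m i k)))
    (∑ℚ.sum-cong-≗ (λ i → cong (λ s → c₂ i ℚ.* [ vs , unitVectors f ]′ s j) (Fin.splitAt-↑ʳ m k i))))))
    (proj₂ (proj₂ dep) j)
  -- Applying `N` to the relation kills the null vectors, so the unit-vector part alone is in the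
  -- kernel; its rows at `f i` are those of the principal submatrix.
  Nc₂≡0 : ∀ i → ∑ℚ.sum (λ j → c₂ j ℚ.* ι (N i (f j))) ≡ 0ℚ
  Nc₂≡0 i = begin
    ∑ℚ.sum (λ j → c₂ j ℚ.* ι (N i (f j)))
      ≡⟨ ≡.sym (∑-comb-unit (ι ∘ N i) f c₂) ⟩
    ∑ℚ.sum (λ j → ι (N i j) ℚ.* comb (unitVectors f) c₂ j)
      ≡⟨ ≡.sym (ℚ.+-identityˡ _) ⟩
    0ℚ ℚ.+ ∑ℚ.sum (λ j → ι (N i j) ℚ.* comb (unitVectors f) c₂ j)
      ≡⟨ cong (ℚ._+ ∑ℚ.sum (λ j → ι (N i j) ℚ.* comb (unitVectors f) c₂ j)) (≡.sym (Null-comb {N = N} {vs} c₁ null i)) ⟩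
    ∑ℚ.sum (λ j → ι (N i j) ℚ.* comb vs c₁ j) ℚ.+ ∑ℚ.sum (λ j → ι (N i j) ℚ.* comb (unitVectors f) c₂ j)
      ≡⟨ ≡.sym (∑ℚ.∑-distrib-+ (λ j → ι (N i j) ℚ.* comb vs c₁ j) _) ⟩
    ∑ℚ.sum (λ j → ι (N i j) ℚ.* comb vs c₁ j ℚ.+ ι (N i j) ℚ.* comb (unitVectors f) c₂ j)
      ≡⟨ ∑-zero (λ j → ≡.trans (≡.sym (ℚ.*-distribˡ-+ (ι (N i j)) (comb vs c₁ j) _))
           (≡.trans (cong (ι (N i j) ℚ.*_) (sum≡0 j)) (ℚ.*-zeroʳ (ι (N i j))))) ⟩
    0ℚ ∎
  c₂≡0 : ∀ j → c₂ j ≡ 0ℚ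
  c₂≡0 = TrivialKernel⇒ℚ {N = λ i j → N (f i) (f j)} triv c₂ (λ i → Nc₂≡0 (f i))
  c₁≡0 : ∀ i → c₁ i ≡ 0ℚ
  c₁≡0 = indep c₁ (λ j → ≡.trans (≡.sym (ℚ.+-identityʳ _)) (≡.trans
    (cong (comb vs c₁ j ℚ.+_) (≡.sym (∑-zero (λ i → ≡.trans (cong (ℚ._* ι (δ (f i) j)) (c₂≡0 i)) (ℚ.*-zeroˡ (ι (δ (f i) j)))))))
    (sum≡0 j)))
  c≡0 : ∀ i → c i ≡ 0ℚ
  c≡0 i with splitAt m i in eq
  ... | inj₁ l = ≡.trans (cong c (≡.sym (Fin.splitAt⁻¹-↑ˡ eq))) (c₁≡0 l)
  ... | inj₂ r = ≡.trans (cong c (≡.sym (Fin.splitAt⁻¹-↑ʳ eq))) (c₂≡0 r)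

-- Restricted to the coordinates `f`, the vectors form a diagonal matrix, so the coordinate `f i` of
-- a vanishing combination isolates `c i`.
diagonal⇒Indep : ∀ {n k} (vs : Fin k → Fin n → ℚ) (f : Fin k → Fin n) →
  (∀ i → vs i (f i) ≢ 0ℚ) → (∀ i j → i ≢ j → vs i (f j) ≡ 0ℚ) → Indep vs
diagonal⇒Indep {k = suc k} vs f diag off c cv≡0 i = p≢0∧p*q≡0⇒q≡0 (diag i) (begin
  vs i (f i) ℚ.* c i      ≡⟨ ℚ.*-comm (vs i (f i)) (c i) ⟩
  c i ℚ.* vs i (f i)      ≡⟨ ≡.sym (ℚ.+-identityʳ _) ⟩
  c i ℚ.* vs i (f i) ℚ.+ 0ℚ
    ≡⟨ cong (c i ℚ.* vs i (f i) ℚ.+_) (≡.sym (∑-zero (λ j → ≡.trans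
         (cong (c (punchIn i j) ℚ.*_) (off (punchIn i j) i (Fin.punchInᵢ≢i i j))) (ℚ.*-zeroʳ (c (punchIn i j)))))) ⟩
  c i ℚ.* vs i (f i) ℚ.+ ∑ℚ.sum (λ j → c (punchIn i j) ℚ.* vs (punchIn i j) (f i))
    ≡⟨ ≡.sym (∑ℚ.sum-remove {i = i} (λ j → c j ℚ.* vs j (f i))) ⟩
  comb vs c (f i)         ≡⟨ cv≡0 (f i) ⟩
  0ℚ                      ∎)
  where open ≡-Reasoning

-- Integer matrices with trivial kernel

∑ℤ-zero : ∀ {n} {f : Fin n → ℤ} → (∀ i → f i ≡ 0ℤ) → ∑ℤ.sum f ≡ 0ℤ
∑ℤ-zero {n} f≡0 = ≡.trans (∑ℤ.sum-cong-≗ f≡0) (∑ℤ.sum-replicate-zero n)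

∑ℤ-δ : ∀ {n} a (g : Fin n → ℤ) → ∑ℤ.sum (λ j → δ a j ℤ.* g j) ≡ g a
∑ℤ-δ zero    g = ≡.trans (cong₂ ℤ._+_ (ℤ.*-identityˡ (g zero)) (∑ℤ-zero {f = λ j → 0ℤ ℤ.* g (suc j)} (λ j → ℤ.*-zeroˡ (g (suc j)))))
  (ℤ.+-identityʳ (g zero))
∑ℤ-δ (suc a) g = ≡.trans (cong₂ ℤ._+_ (ℤ.*-zeroˡ (g zero)) (∑ℤ-δ a (g ∘ suc))) (ℤ.+-identityˡ _)

dot : ∀ {w} → Vec ℤ w → (Fin w → ℤ) → ℤ
dot []      p = 0ℤ
dot (a ∷ r) p = a ℤ.* p zero ℤ.+ dot r (p ∘ suc)

lincomb : ∀ {w} → ℤ → Vec ℤ w → ℤ → Vec ℤ w → Vec ℤ w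
lincomb a s b r = Vec.zipWith (λ x y → a ℤ.* x ℤ.- b ℤ.* y) s r

dot-lincomb : ∀ {w} a (s : Vec ℤ w) b r p → dot (lincomb a s b r) p ≡ a ℤ.* dot s p ℤ.- b ℤ.* dot r p
dot-lincomb a []      b []      p = solve 2 (λ a b → con 0ℤ := a :* con 0ℤ :- b :* con 0ℤ) refl a b
  where open ℤSolver.+-*-Solver
dot-lincomb a (x ∷ s) b (y ∷ r) p = ≡.trans (cong (λ z → (a ℤ.* x ℤ.- b ℤ.* y) ℤ.* p zero ℤ.+ z) (dot-lincomb a s b r (p ∘ suc)))
  (solve 7 (λ a x b y q u v → (a :* x :- b :* y) :* q :+ (a :* u :- b :* v) := a :* (x :* q :+ u) :- b :* (y :* q :+ v))
    refl a x b y (p zero) (dot s (p ∘ suc)) (dot r (p ∘ suc)))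
  where open ℤSolver.+-*-Solver

eliminateRow : ∀ {w} → ℤ → Vec ℤ w → Vec ℤ (suc w) → Vec ℤ w
eliminateRow a r (b ∷ s) = lincomb a s b r

-- Fraction-free elimination of the first column. `done` keeps the rows met before the pivot, whose
-- leading entry is zero and already dropped; `nothing` means that the whole column vanishes.
eliminate : ∀ {w} → List (Vec ℤ (suc w)) → List (Vec ℤ w) → Maybe (List (Vec ℤ w))
eliminate []             done = nothing
eliminate ((a ∷ r) ∷ rs) done with a ℤ.≟ 0ℤ
... | yes _ = eliminate rs (r ∷ done)
... | no _  = just (done ++ List.map (eliminateRow a r) rs)

trivialKernelᵇ : ∀ {w} → List (Vec ℤ w) → Bool
trivialKernelᵇ {zero}  rs = true
trivialKernelᵇ {suc w} rs with eliminate rs []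
... | nothing  = false
... | just rs′ = trivialKernelᵇ rs′

-- The tail of a kernel vector is killed by the reduced rows, and the pivot row recovers the first
-- coordinate from the tail because its leading entry is nonzero.
eliminate-sound : ∀ {w} (p : Fin (suc w) → ℤ) rs done {rs′} → eliminate rs done ≡ just rs′ →
  All (λ r → dot r p ≡ 0ℤ) rs → All (λ r → dot r (p ∘ suc) ≡ 0ℤ) done →
  All (λ r → dot r (p ∘ suc) ≡ 0ℤ) rs′ × ((∀ j → p (suc j) ≡ 0ℤ) → p zero ≡ 0ℤ)
eliminate-sound p ((a ∷ r) ∷ rs) done e (ap≡0 ∷ rsp≡0) donep≡0 with a ℤ.≟ 0ℤ
... | yes refl = eliminate-sound p rs (r ∷ done) e rsp≡0
      (≡.trans (≡.sym (≡.trans (cong (ℤ._+ dot r (p ∘ suc)) (ℤ.*-zeroˡ (p zero))) (ℤ.+-identityˡ _))) ap≡0 ∷ donep≡0)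
eliminate-sound {w} p ((a ∷ r) ∷ rs) done refl (ap≡0 ∷ rsp≡0) donep≡0 | no a≢0 =
  All.++⁺ donep≡0 (All.map⁺ (All.map (λ {s} → reduced s) rsp≡0)) , p₀≡0
  where
  open ≡-Reasoning
  reduced : (s : Vec ℤ (suc w)) → dot s p ≡ 0ℤ → dot (eliminateRow a r s) (p ∘ suc) ≡ 0ℤ
  reduced (b ∷ s) bp≡0 = begin
    dot (lincomb a s b r) (p ∘ suc)                      ≡⟨ dot-lincomb a s b r (p ∘ suc) ⟩
    a ℤ.* dot s (p ∘ suc) ℤ.- b ℤ.* dot r (p ∘ suc)
      ≡⟨ solve 5 (λ a b u v q → a :* u :- b :* v := a :* (b :* q :+ u) :- b :* (a :* q :+ v)) refl
           a b (dot s (p ∘ suc)) (dot r (p ∘ suc)) (p zero) ⟩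
    a ℤ.* dot (b ∷ s) p ℤ.- b ℤ.* dot (a ∷ r) p          ≡⟨ cong₂ (λ x y → a ℤ.* x ℤ.- b ℤ.* y) bp≡0 ap≡0 ⟩
    a ℤ.* 0ℤ ℤ.- b ℤ.* 0ℤ                                ≡⟨ cong₂ ℤ._-_ (ℤ.*-zeroʳ a) (ℤ.*-zeroʳ b) ⟩
    0ℤ                                                   ∎
    where open ℤSolver.+-*-Solver
  dot-zero : ∀ {v} (t : Vec ℤ v) {q} → (∀ j → q j ≡ 0ℤ) → dot t q ≡ 0ℤ
  dot-zero []      q≡0 = refl
  dot-zero (c ∷ t) q≡0 = cong₂ ℤ._+_ (≡.trans (cong (c ℤ.*_) (q≡0 zero)) (ℤ.*-zeroʳ c)) (dot-zero t (q≡0 ∘ suc))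
  p₀≡0 : (∀ j → p (suc j) ≡ 0ℤ) → p zero ≡ 0ℤ
  p₀≡0 tail≡0 with ℤ.i*j≡0⇒i≡0∨j≡0 a (≡.trans (≡.sym (≡.trans (cong (λ z → a ℤ.* p zero ℤ.+ z) (dot-zero r tail≡0))
                     (ℤ.+-identityʳ _))) ap≡0)
  ... | inj₁ a≡0 = contradiction a≡0 a≢0
  ... | inj₂ p≡0 = p≡0

trivialKernelᵇ-sound : ∀ {w} (rs : List (Vec ℤ w)) → trivialKernelᵇ rs ≡ true →
  ∀ p → All (λ r → dot r p ≡ 0ℤ) rs → ∀ j → p j ≡ 0ℤ
trivialKernelᵇ-sound {suc w} rs triv p rsp≡0 j with eliminate rs [] in e
... | just rs′ with eliminate-sound p rs [] e rsp≡0 []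
... | rs′p≡0 , p₀≡0 with j
... | zero  = p₀≡0 (trivialKernelᵇ-sound rs′ triv (p ∘ suc) rs′p≡0)
... | suc j = trivialKernelᵇ-sound rs′ triv (p ∘ suc) rs′p≡0 j

rows : ∀ {l k} → (Fin l → Fin k → ℤ) → List (Vec ℤ k)
rows N = List.tabulate (λ i → Vec.tabulate (N i))

rows-sound : ∀ {l k} (N : Fin l → Fin k → ℤ) → trivialKernelᵇ (rows N) ≡ true → TrivialKernel N
rows-sound N triv p Np≡0 = trivialKernelᵇ-sound (rows N) triv p
  (All.tabulate⁺ (λ i → ≡.trans (dot-tabulate (N i) p) (Np≡0 i)))
  where
  dot-tabulate : ∀ {k} (f p : Fin k → ℤ) → dot (Vec.tabulate f) p ≡ ∑ℤ.sum (λ j → f j ℤ.* p j)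
  dot-tabulate {zero}  f p = refl
  dot-tabulate {suc k} f p = cong (λ z → f zero ℤ.* p zero ℤ.+ z) (dot-tabulate (f ∘ suc) (p ∘ suc))

n<2^n : ∀ n → n < 2 ℕ.^ n
n<2^n zero    = s≤s z≤n
n<2^n (suc n) = ℕ.+-mono-≤ (ℕ.≤-trans (s≤s z≤n) (n<2^n n)) (ℕ.≤-trans (n<2^n n) (ℕ.m≤m+n _ 0))

-- Choosing ∣p∣ itself as the exponent is enough: k^∣p∣ already exceeds ∣p∣, so no nonzero multiple
-- of it has absolute value ∣p∣.
k^∣∣p∣⇒p≡0 : ∀ {k} p s → 2 ≤ k → p ≡ + (k ℕ.^ ℤ.∣ p ∣) ℤ.* s → p ≡ 0ℤ
k^∣∣p∣⇒p≡0 {k} p s 2≤k eq = by-size ℤ.∣ s ∣ refl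
  where
  open ℕ.≤-Reasoning
  by-size : ∀ t → ℤ.∣ s ∣ ≡ t → p ≡ 0ℤ
  by-size zero    ∣s∣ = ≡.trans eq (≡.trans (cong (+ (k ℕ.^ ℤ.∣ p ∣) ℤ.*_) (ℤ.∣i∣≡0⇒i≡0 ∣s∣)) (ℤ.*-zeroʳ (+ (k ℕ.^ ℤ.∣ p ∣))))
  by-size (suc t) ∣s∣ = contradiction (begin-strict
    ℤ.∣ p ∣                     <⟨ n<2^n ℤ.∣ p ∣ ⟩
    2 ℕ.^ ℤ.∣ p ∣               ≤⟨ ℕ.^-monoˡ-≤ ℤ.∣ p ∣ 2≤k ⟩
    k ℕ.^ ℤ.∣ p ∣               ≤⟨ ℕ.m≤m*n (k ℕ.^ ℤ.∣ p ∣) (suc t) ⟩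
    k ℕ.^ ℤ.∣ p ∣ ℕ.* suc t     ≡⟨ cong (k ℕ.^ ℤ.∣ p ∣ ℕ.*_) (≡.sym ∣s∣) ⟩
    k ℕ.^ ℤ.∣ p ∣ ℕ.* ℤ.∣ s ∣   ≡⟨ ≡.sym (ℤ.abs-* (+ (k ℕ.^ ℤ.∣ p ∣)) s) ⟩
    ℤ.∣ + (k ℕ.^ ℤ.∣ p ∣) ℤ.* s ∣ ≡⟨ cong ℤ.∣_∣ (≡.sym eq) ⟩
    ℤ.∣ p ∣                     ∎) (ℕ.<-irrefl refl)

-- A null vector p satisfies p = − k q p, so every power of k divides it.
I+kQ-trivialKernel : ∀ {w} k → 2 ≤ k → (N q : Fin w → Fin w → ℤ) →
  (∀ i j → N i j ≡ δ i j ℤ.+ + k ℤ.* q i j) → TrivialKernel N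
I+kQ-trivialKernel {w} k 2≤k N q N≡ p Np≡0 i =
  k^∣∣p∣⇒p≡0 (p i) (proj₁ (powers ℤ.∣ p i ∣) i) 2≤k (proj₂ (powers ℤ.∣ p i ∣) i)
  where
  open ≡-Reasoning
  open ℤSolver.+-*-Solver
  negated : ∀ i → p i ≡ ℤ.- (+ k ℤ.* ∑ℤ.sum (λ j → q i j ℤ.* p j))
  negated i = begin
    p i
      ≡⟨ solve 2 (λ x y → x := (x :+ y) :+ :- y) refl (p i) (+ k ℤ.* ∑ℤ.sum (λ j → q i j ℤ.* p j)) ⟩
    (p i ℤ.+ + k ℤ.* ∑ℤ.sum (λ j → q i j ℤ.* p j)) ℤ.+ ℤ.- (+ k ℤ.* ∑ℤ.sum (λ j → q i j ℤ.* p j))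
      ≡⟨ cong (ℤ._+ ℤ.- (+ k ℤ.* ∑ℤ.sum (λ j → q i j ℤ.* p j))) (≡.sym (begin
           0ℤ                                              ≡⟨ ≡.sym (Np≡0 i) ⟩
           ∑ℤ.sum (λ j → N i j ℤ.* p j)                    ≡⟨ ∑ℤ.sum-cong-≗ (λ j → ≡.trans (cong (ℤ._* p j) (N≡ i j))
             (solve 4 (λ d k q p → (d :+ k :* q) :* p := d :* p :+ k :* (q :* p)) refl (δ i j) (+ k) (q i j) (p j))) ⟩
           ∑ℤ.sum (λ j → δ i j ℤ.* p j ℤ.+ + k ℤ.* (q i j ℤ.* p j))
             ≡⟨ ∑ℤ.∑-distrib-+ (λ j → δ i j ℤ.* p j) (λ j → + k ℤ.* (q i j ℤ.* p j)) ⟩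
           ∑ℤ.sum (λ j → δ i j ℤ.* p j) ℤ.+ ∑ℤ.sum (λ j → + k ℤ.* (q i j ℤ.* p j))
             ≡⟨ cong₂ ℤ._+_ (∑ℤ-δ i p) (≡.sym (∑ℤ.*-distribˡ-sum (+ k) (λ j → q i j ℤ.* p j))) ⟩
           p i ℤ.+ + k ℤ.* ∑ℤ.sum (λ j → q i j ℤ.* p j)    ∎)) ⟩
    0ℤ ℤ.+ ℤ.- (+ k ℤ.* ∑ℤ.sum (λ j → q i j ℤ.* p j))
      ≡⟨ ℤ.+-identityˡ _ ⟩
    ℤ.- (+ k ℤ.* ∑ℤ.sum (λ j → q i j ℤ.* p j)) ∎
  powers : ∀ t → Σ[ s ∈ (Fin w → ℤ) ] ∀ i → p i ≡ + (k ℕ.^ t) ℤ.* s i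
  powers zero    = p , λ i → ≡.sym (ℤ.*-identityˡ (p i))
  powers (suc t) with powers t
  ... | s , p≡ = (λ i → ℤ.- ∑ℤ.sum (λ j → q i j ℤ.* s j)) , λ i → begin
    p i                                                        ≡⟨ negated i ⟩
    ℤ.- (+ k ℤ.* ∑ℤ.sum (λ j → q i j ℤ.* p j))                 ≡⟨ cong (λ x → ℤ.- (+ k ℤ.* x)) (begin
      ∑ℤ.sum (λ j → q i j ℤ.* p j)                             ≡⟨ ∑ℤ.sum-cong-≗ (λ j → ≡.trans (cong (q i j ℤ.*_) (p≡ j))
         (solve 3 (λ q K s → q :* (K :* s) := K :* (q :* s)) refl (q i j) (+ (k ℕ.^ t)) (s j))) ⟩
      ∑ℤ.sum (λ j → + (k ℕ.^ t) ℤ.* (q i j ℤ.* s j))           ≡⟨ ≡.sym (∑ℤ.*-distribˡ-sum (+ (k ℕ.^ t)) (λ j → q i j ℤ.* s j)) ⟩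
      + (k ℕ.^ t) ℤ.* ∑ℤ.sum (λ j → q i j ℤ.* s j)             ∎) ⟩
    ℤ.- (+ k ℤ.* (+ (k ℕ.^ t) ℤ.* ∑ℤ.sum (λ j → q i j ℤ.* s j)))
      ≡⟨ solve 3 (λ k K x → :- (k :* (K :* x)) := (k :* K) :* (:- x)) refl (+ k) (+ (k ℕ.^ t)) _ ⟩
    + k ℤ.* + (k ℕ.^ t) ℤ.* ℤ.- ∑ℤ.sum (λ j → q i j ℤ.* s j)
      ≡⟨ cong (ℤ._* _) (≡.sym (ℤ.pos-* k (k ℕ.^ t))) ⟩
    + (k ℕ.^ suc t) ℤ.* ℤ.- ∑ℤ.sum (λ j → q i j ℤ.* s j)       ∎

-- The determinant of this arrowhead matrix is 1 - ∑ aⱼ².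
star : ∀ {e} → (Fin e → ℕ) → Fin (suc e) → Fin (suc e) → ℤ
star a zero    zero    = 1ℤ
star a zero    (suc j) = + a j
star a (suc i) zero    = + a i
star a (suc i) (suc j) = δ i j

∑-squares : ∀ {e} (a : Fin e → ℕ) → (∀ j → a j ≢ 1) → Σ[ t ∈ ℕ ] ∑ℤ.sum (λ j → + a j ℤ.* + a j) ≡ + t × t ≢ 1
∑-squares {zero}  a a≢1 = 0 , refl , λ ()
∑-squares {suc e} a a≢1 with ∑-squares (a ∘ suc) (a≢1 ∘ suc)
... | t , ∑≡t , t≢1 = a zero ℕ.* a zero + t , cong₂ ℤ._+_ (≡.sym (ℤ.pos-* (a zero) (a zero))) ∑≡t , sum≢1
  where
  sum≢1 : a zero ℕ.* a zero + t ≢ 1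
  sum≢1 eq with a zero | a≢1 zero
  ... | 0 | _ = t≢1 eq
  ... | 1 | 1≢1 = 1≢1 refl
  ... | suc (suc b) | _ with () ← eq

-- The leaf rows give pⱼ = -aⱼ p₀, which turns the centre row into (1 - ∑ aⱼ²) p₀ = 0. A sum of
-- squares of naturals equals 1 only if one of them is 1.
star-trivialKernel : ∀ {e} (a : Fin e → ℕ) → (∀ j → a j ≢ 1) → TrivialKernel (star a)
star-trivialKernel {e} a a≢1 p Np≡0 = λ { zero → p₀≡0 ; (suc j) → leaf j ⟨ ≡.trans ⟩ cong (λ x → ℤ.- (+ a j ℤ.* x)) p₀≡0 ⟨ ≡.trans ⟩ zero-leaf j }
  where
  open ≡-Reasoning
  open ℤSolver.+-*-Solver
  zero-leaf : ∀ j → ℤ.- (+ a j ℤ.* 0ℤ) ≡ 0ℤ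
  zero-leaf j = cong ℤ.-_ (ℤ.*-zeroʳ (+ a j))
  leaf : ∀ j → p (suc j) ≡ ℤ.- (+ a j ℤ.* p zero)
  leaf j = begin
    p (suc j)
      ≡⟨ solve 2 (λ x y → x := y :+ x :+ :- y) refl (p (suc j)) (+ a j ℤ.* p zero) ⟩
    + a j ℤ.* p zero ℤ.+ p (suc j) ℤ.+ ℤ.- (+ a j ℤ.* p zero)
      ≡⟨ cong (λ x → + a j ℤ.* p zero ℤ.+ x ℤ.+ ℤ.- (+ a j ℤ.* p zero)) (≡.sym (∑ℤ-δ j (p ∘ suc))) ⟩
    ∑ℤ.sum (λ i → star a (suc j) i ℤ.* p i) ℤ.+ ℤ.- (+ a j ℤ.* p zero)
      ≡⟨ cong (ℤ._+ ℤ.- (+ a j ℤ.* p zero)) (Np≡0 (suc j)) ⟩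
    0ℤ ℤ.+ ℤ.- (+ a j ℤ.* p zero)
      ≡⟨ ℤ.+-identityˡ _ ⟩
    ℤ.- (+ a j ℤ.* p zero) ∎
  S = ∑ℤ.sum (λ j → + a j ℤ.* + a j)
  squares : ∑ℤ.sum (λ j → + a j ℤ.* p (suc j)) ≡ S ℤ.* ℤ.- p zero
  squares = begin
    ∑ℤ.sum (λ j → + a j ℤ.* p (suc j))                    ≡⟨ ∑ℤ.sum-cong-≗ (λ j → ≡.trans (cong (+ a j ℤ.*_) (leaf j))
      (solve 2 (λ a x → a :* (:- (a :* x)) := a :* a :* (:- x)) refl (+ a j) (p zero))) ⟩
    ∑ℤ.sum (λ j → + a j ℤ.* + a j ℤ.* ℤ.- p zero)         ≡⟨ ≡.sym (∑ℤ.*-distribʳ-sum (ℤ.- p zero) (λ j → + a j ℤ.* + a j)) ⟩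
    S ℤ.* ℤ.- p zero                                      ∎
  product≡0 : (1ℤ ℤ.- S) ℤ.* p zero ≡ 0ℤ
  product≡0 = begin
    (1ℤ ℤ.- S) ℤ.* p zero               ≡⟨ solve 2 (λ s x → (con 1ℤ :- s) :* x := con 1ℤ :* x :+ s :* (:- x)) refl S (p zero) ⟩
    1ℤ ℤ.* p zero ℤ.+ S ℤ.* ℤ.- p zero  ≡⟨ cong (λ z → 1ℤ ℤ.* p zero ℤ.+ z) (≡.sym squares) ⟩
    ∑ℤ.sum (λ i → star a zero i ℤ.* p i) ≡⟨ Np≡0 zero ⟩
    0ℤ                                  ∎
  p₀≡0 : p zero ≡ 0ℤ
  p₀≡0 with ∑-squares a a≢1 | ℤ.i*j≡0⇒i≡0∨j≡0 (1ℤ ℤ.- S) product≡0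
  ... | _ | inj₂ p≡0 = p≡0
  ... | t , S≡t , t≢1 | inj₁ 1-S≡0 =
    contradiction (ℤ.+-injective (≡.trans (≡.sym S≡t) (≡.sym (ℤ.i-j≡0⇒i≡j 1ℤ S 1-S≡0)))) t≢1

-- Walks and distances

≡true⇒T : ∀ {b} → b ≡ true → T b
≡true⇒T refl = _

∨-trueˡ : ∀ {a b} → a ≡ true → a ∨ b ≡ true
∨-trueˡ refl = refl

∨-trueʳ : ∀ {a b} → b ≡ true → a ∨ b ≡ true
∨-trueʳ {true}  _ = refl
∨-trueʳ {false} e = e

∨-true⁻ : ∀ {a b} → a ∨ b ≡ true → (a ≡ true) ⊎ (b ≡ true)
∨-true⁻ {true}  _ = inj₁ refl
∨-true⁻ {false} e = inj₂ e

∧-true : ∀ {a b} → a ≡ true → b ≡ true → a ∧ b ≡ true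
∧-true refl refl = refl

∧-true⁻ : ∀ {a b} → a ∧ b ≡ true → (a ≡ true) × (b ≡ true)
∧-true⁻ {true} e = refl , e

bool-ext : ∀ {a b : Bool} → (a ≡ true → b ≡ true) → (b ≡ true → a ≡ true) → a ≡ b
bool-ext {true}  {true}  _ _ = refl
bool-ext {true}  {false} f _ = ≡.sym (f refl)
bool-ext {false} {true}  _ g = g refl
bool-ext {false} {false} _ _ = refl

anyFin-true : ∀ {n} {f : Fin n → Bool} i → f i ≡ true → anyFin f ≡ true
anyFin-true zero    e = ∨-trueˡ e
anyFin-true (suc i) e = ∨-trueʳ (anyFin-true i e)

anyFin-true⁻ : ∀ {n} {f : Fin n → Bool} → anyFin f ≡ true → ∃ λ i → f i ≡ true
anyFin-true⁻ {suc n} e with ∨-true⁻ e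
... | inj₁ e₀ = zero , e₀
... | inj₂ e′ with anyFin-true⁻ e′
... | i , eᵢ = suc i , eᵢ

anyFin-false⁻ : ∀ {n} {f : Fin n → Bool} → anyFin f ≡ false → ∀ i → f i ≡ false
anyFin-false⁻ {f = f} e i with f i in fi
... | false = refl
... | true with () ← ≡.trans (≡.sym e) (anyFin-true i fi)

maxFin-upper : ∀ {n} (f : Fin n → ℕ) i → f i ≤ maxFin f
maxFin-upper f zero    = ℕ.m≤m⊔n (f zero) _
maxFin-upper f (suc i) = ℕ.≤-trans (maxFin-upper (f ∘ suc) i) (ℕ.m≤n⊔m (f zero) _)

maxFin-least : ∀ {n} (f : Fin n → ℕ) {b} → (∀ i → f i ≤ b) → maxFin f ≤ b
maxFin-least {zero}  f f≤b = z≤n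
maxFin-least {suc n} f f≤b = ℕ.⊔-lub (f≤b zero) (maxFin-least (f ∘ suc) (f≤b ∘ suc))

maxFin-attained : ∀ {n} (f : Fin n → ℕ) → Fin n → ∃ λ i → f i ≡ maxFin f
maxFin-attained {suc zero}    f _ = zero , ≡.sym (ℕ.⊔-identityʳ (f zero))
maxFin-attained {suc (suc n)} f _ with ℕ.⊔-sel (f zero) (maxFin (f ∘ suc)) | maxFin-attained (f ∘ suc) zero
... | inj₁ e | _      = zero , ≡.sym e
... | inj₂ e | i , fi = suc i , ≡.trans fi (≡.sym e)

search-least : ∀ fuel (p : ℕ → Bool) i {k} → i ≤ k → k < i + fuel → p k ≡ true →
  p (search fuel p i) ≡ true × search fuel p i ≤ k
search-least zero       p i i≤k k<i _ = contradiction (ℕ.≤-<-trans i≤k (subst (_ <_) (ℕ.+-identityʳ i) k<i)) (ℕ.<-irrefl refl)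
search-least (suc fuel) p i {k} i≤k k<i+f pk with p i in pi
... | true  = pi , i≤k
... | false with i ℕ.≟ k
... | yes refl with () ← ≡.trans (≡.sym pi) pk
... | no i≢k = search-least fuel p (suc i) (ℕ.≤∧≢⇒< i≤k i≢k) (subst (k <_) (ℕ.+-suc i fuel) k<i+f) pk

module Within {n} (G : Graph n) where

  within-0⁻ : ∀ {u v} → within G 0 u v ≡ true → u ≡ v
  within-0⁻ {u} {v} e with u ≟ v
  ... | yes u≡v = u≡v

  within-refl : ∀ u → within G 0 u u ≡ true
  within-refl u with u ≟ u
  ... | yes _ = refl
  ... | no u≢u = contradiction refl u≢u

  within-mono : ∀ {k l u v} → k ≤ l → within G k u v ≡ true → within G l u v ≡ true
  within-mono {l = l} k≤l e = go (ℕ.≤⇒≤′ k≤l) e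
    where
    go : ∀ {k l u v} → k ℕ.≤′ l → within G k u v ≡ true → within G l u v ≡ true
    go ℕ.≤′-refl     e = e
    go (ℕ.≤′-step s) e = ∨-trueˡ (go s e)

  within-adj : ∀ {k u v w} → within G k u w ≡ true → adj G w v ≡ true → within G (suc k) u v ≡ true
  within-adj {w = w} e a = ∨-trueʳ (anyFin-true w (∧-true e a))

  adj⇒within : ∀ {u v} → adj G u v ≡ true → within G 1 u v ≡ true
  adj⇒within a = within-adj {0} (within-refl _) a

  within-suc⁻ : ∀ {k u v} → within G (suc k) u v ≡ true →
    (within G k u v ≡ true) ⊎ (∃ λ w → within G k u w ≡ true × adj G w v ≡ true)
  within-suc⁻ {k} {u} {v} e with ∨-true⁻ {within G k u v} e
  ... | inj₁ e′ = inj₁ e′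
  ... | inj₂ e′ with anyFin-true⁻ e′
  ... | w , e″ = inj₂ (w , ∧-true⁻ e″)

  within-1⁻ : ∀ {u v} → within G 1 u v ≡ true → (u ≡ v) ⊎ (adj G u v ≡ true)
  within-1⁻ e with within-suc⁻ {0} e
  ... | inj₁ e′ = inj₁ (within-0⁻ e′)
  ... | inj₂ (w , e′ , a) with refl ← within-0⁻ e′ = inj₂ a

  within-trans : ∀ a b {u v w} → within G a u w ≡ true → within G b w v ≡ true → within G (b + a) u v ≡ true
  within-trans a zero    e f with refl ← within-0⁻ f = e
  within-trans a (suc b) e f with within-suc⁻ {b} f
  ... | inj₁ f′           = ∨-trueˡ (within-trans a b e f′)
  ... | inj₂ (x , f′ , g) = within-adj {b + a} (within-trans a b e f′) g

  within-sym : ∀ k {u v} → within G k u v ≡ true → within G k v u ≡ true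
  within-sym zero    e with refl ← within-0⁻ e = e
  within-sym (suc k) {u} {v} e with within-suc⁻ {k} e
  ... | inj₁ e′           = ∨-trueˡ (within-sym k e′)
  ... | inj₂ (w , e′ , a) = subst (λ l → within G l v u ≡ true) (ℕ.+-comm k 1)
    (within-trans 1 k (adj⇒within (≡.trans (Graph.sym G v w) a)) (within-sym k e′))

module Distance {n} (G : Graph n) (conn : Connected G) where
  open Within G

  dist-spec : ∀ {u v k} → k ≤ n → within G k u v ≡ true →
    within G (dist G u v) u v ≡ true × dist G u v ≤ k
  dist-spec {u} {v} k≤n e = search-least (suc n) (λ i → within G i u v) 0 z≤n (s≤s k≤n) e

  within-dist : ∀ u v → within G (dist G u v) u v ≡ true
  within-dist u v = proj₁ (dist-spec ℕ.≤-refl (conn u v))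

  within⇒dist≤ : ∀ k {u v} → within G k u v ≡ true → dist G u v ≤ k
  within⇒dist≤ k {u} {v} e with ℕ.≤-total k n
  ... | inj₁ k≤n = proj₂ (dist-spec k≤n e)
  -- The search stops at length `n`, so a larger `k` is handled by the bound `n` that connectedness
  -- provides.
  ... | inj₂ n≤k = ℕ.≤-trans (proj₂ (dist-spec ℕ.≤-refl (conn u v))) n≤k

  dist≤⇒within : ∀ {k u v} → dist G u v ≤ k → within G k u v ≡ true
  dist≤⇒within {u = u} {v} d≤k = within-mono d≤k (within-dist u v)

  dist-refl : ∀ u → dist G u u ≡ 0
  dist-refl u = ℕ.n≤0⇒n≡0 (within⇒dist≤ 0 (within-refl u))

  dist-sym : ∀ u v → dist G u v ≡ dist G v u
  dist-sym u v = ℕ.≤-antisym (within⇒dist≤ (dist G v u) (within-sym (dist G v u) (within-dist v u)))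
                             (within⇒dist≤ (dist G u v) (within-sym (dist G u v) (within-dist u v)))

  dist-triangle : ∀ u w v → dist G u v ≤ dist G u w + dist G w v
  dist-triangle u w v = subst (dist G u v ≤_) (ℕ.+-comm (dist G w v) (dist G u w))
    (within⇒dist≤ (dist G w v + dist G u w) (within-trans (dist G u w) (dist G w v) (within-dist u w) (within-dist w v)))

  dist≡0⇒≡ : ∀ {u v} → dist G u v ≡ 0 → u ≡ v
  dist≡0⇒≡ {u} {v} d≡0 = within-0⁻ (dist≤⇒within (ℕ.≤-reflexive d≡0))

  dist≡1⇒adj : ∀ {u v} → dist G u v ≡ 1 → adj G u v ≡ true
  dist≡1⇒adj {u} {v} d≡1 with within-1⁻ (dist≤⇒within (ℕ.≤-reflexive d≡1))
  ... | inj₂ a = a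
  ... | inj₁ refl with () ← ≡.trans (≡.sym d≡1) (dist-refl u)

  1≤dist : ∀ {u v} → u ≢ v → 1 ≤ dist G u v
  1≤dist {u} {v} u≢v with dist G u v in d
  ... | zero  = contradiction (dist≡0⇒≡ d) u≢v
  ... | suc _ = s≤s z≤n

  adj⇒≢ : ∀ {u v} → adj G u v ≡ true → u ≢ v
  adj⇒≢ {u} a refl with () ← ≡.trans (≡.sym a) (irrefl G u)

  adj⇒dist≡1 : ∀ {u v} → adj G u v ≡ true → dist G u v ≡ 1
  adj⇒dist≡1 a = ℕ.≤-antisym (within⇒dist≤ 1 (adj⇒within a)) (1≤dist (adj⇒≢ a))

  ¬adj⇒2≤dist : ∀ {u v} → u ≢ v → adj G u v ≡ false → 2 ≤ dist G u v
  ¬adj⇒2≤dist {u} {v} u≢v ¬a with dist G u v in d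
  ... | zero        = contradiction (dist≡0⇒≡ d) u≢v
  ... | suc (suc _) = s≤s (s≤s z≤n)
  ... | suc zero with () ← ≡.trans (≡.sym ¬a) (dist≡1⇒adj d)

  dist≤ecc : ∀ u v → dist G u v ≤ ecc G v
  dist≤ecc u v = maxFin-upper (λ u → dist G u v) u

  dist≤ecc′ : ∀ u v → dist G u v ≤ ecc G u
  dist≤ecc′ u v = subst (_≤ ecc G u) (dist-sym v u) (dist≤ecc v u)

  ecc-attained : ∀ v → ∃ λ u → dist G v u ≡ ecc G v
  ecc-attained v with maxFin-attained (λ u → dist G u v) v
  ... | u , e = u , ≡.trans (dist-sym v u) e

  eccEntry-far : ∀ {u v d} → dist G u v ≡ d → ecc G u ℕ.⊓ ecc G v ≡ d → eccEntry G u v ≡ d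
  eccEntry-far {u} {v} d≡ m≡ with dist G u v ℕ.≡ᵇ (ecc G u ℕ.⊓ ecc G v) in e
  ... | true  = d≡
  ... | false = contradiction (subst T e (ℕ.≡⇒≡ᵇ _ _ (≡.trans d≡ (≡.sym m≡)))) λ ()

  eccEntry-near : ∀ {u v} → dist G u v < ecc G u → dist G u v < ecc G v → eccEntry G u v ≡ 0
  eccEntry-near {u} {v} d<u d<v with dist G u v ℕ.≡ᵇ (ecc G u ℕ.⊓ ecc G v) in e
  ... | false = refl
  ... | true  = contradiction (ℕ.≡ᵇ⇒≡ _ _ (≡true⇒T e)) (ℕ.<⇒≢ (ℕ.⊓-glb d<u d<v))

  eccEntry-values : ∀ u v → (eccEntry G u v ≡ 0) ⊎ ((eccEntry G u v ≡ dist G u v) × (dist G u v ≡ ecc G u ℕ.⊓ ecc G v))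
  eccEntry-values u v with dist G u v ℕ.≡ᵇ (ecc G u ℕ.⊓ ecc G v) in e
  ... | true  = inj₂ (refl , ℕ.≡ᵇ⇒≡ _ _ (≡true⇒T e))
  ... | false = inj₁ refl

  eccEntry-refl : ∀ u → eccEntry G u u ≡ 0
  eccEntry-refl u with eccEntry-values u u
  ... | inj₁ e = e
  ... | inj₂ (e , _) = ≡.trans e (dist-refl u)

  eccEntry-sym : ∀ u v → eccEntry G u v ≡ eccEntry G v u
  eccEntry-sym u v = cong₂ (λ d m → if d ℕ.≡ᵇ m then d else 0) (dist-sym u v) (ℕ.⊓-comm (ecc G u) (ecc G v))

  -- `within G d` allows at most d steps, so the walk may pause; `geodesic` excludes pauses by
  -- minimality. Indexing by ℕ keeps the arithmetic of positions free of `Fin`.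
  walk : ∀ d {u v} → within G d u v ≡ true →
    Σ[ g ∈ (ℕ → Fin n) ] g 0 ≡ u × g d ≡ v × (∀ i → i < d → within G 1 (g i) (g (suc i)) ≡ true)
  walk zero    {u} e = (λ _ → u) , refl , within-0⁻ e , λ _ ()
  walk (suc d) {u} {v} e = cons (first (within-suc⁻ {d} (within-sym (suc d) e)))
    where
    -- `within` lengthens walks at the far end, so the reversed walk is split in order to peel a
    -- step off at `u`.
    first : (within G d v u ≡ true) ⊎ (∃ λ w → within G d v w ≡ true × adj G w u ≡ true) →
      ∃ λ w → within G 1 u w ≡ true × within G d w v ≡ true
    first (inj₁ e′)           = u , within-mono {0} {1} z≤n (within-refl u) , within-sym d e′
    first (inj₂ (w , e′ , a)) = w , adj⇒within (≡.trans (Graph.sym G u w) a) , within-sym d e′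
    cons : (∃ λ w → within G 1 u w ≡ true × within G d w v ≡ true) →
      Σ[ g ∈ (ℕ → Fin n) ] g 0 ≡ u × g (suc d) ≡ v × (∀ i → i < suc d → within G 1 (g i) (g (suc i)) ≡ true)
    cons (w , e₁ , e₂) with walk d e₂
    ... | g , refl , gd , steps = (λ { zero → u ; (suc i) → g i }) , refl , gd , λ
      { zero    _         → e₁
      ; (suc i) (s≤s i<d) → steps i i<d }

  geodesic : ∀ u v → Σ[ g ∈ (ℕ → Fin n) ] g 0 ≡ u × g (dist G u v) ≡ v ×
    (∀ i k → i + k ≤ dist G u v → dist G (g i) (g (i + k)) ≡ k)
  geodesic u v with walk (dist G u v) (within-dist u v)
  ... | g , g0 , gd , steps = g , g0 , gd , λ i k i+k≤d → ℕ.≤-antisym (along i k i+k≤d) (ℕ.+-cancelˡ-≤ i k _ (lower i k i+k≤d))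
    where
    open ℕ.≤-Reasoning
    d = dist G u v
    along : ∀ i k → i + k ≤ d → dist G (g i) (g (i + k)) ≤ k
    along i zero    _ = ℕ.≤-reflexive (≡.trans (cong (λ j → dist G (g i) (g j)) (ℕ.+-identityʳ i)) (dist-refl (g i)))
    along i (suc k) i+k<d = begin
      dist G (g i) (g (i + suc k))
        ≤⟨ dist-triangle (g i) (g (i + k)) (g (i + suc k)) ⟩
      dist G (g i) (g (i + k)) + dist G (g (i + k)) (g (i + suc k))
        ≡⟨ cong (λ j → dist G (g i) (g (i + k)) + dist G (g (i + k)) (g j)) (ℕ.+-suc i k) ⟩
      dist G (g i) (g (i + k)) + dist G (g (i + k)) (g (suc (i + k)))
        ≤⟨ ℕ.+-mono-≤ (along i k (ℕ.≤-trans (ℕ.+-monoʳ-≤ i (ℕ.n≤1+n k)) i+k<d))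
                      (within⇒dist≤ 1 (steps (i + k) (subst (_≤ d) (ℕ.+-suc i k) i+k<d))) ⟩
      k + 1 ≡⟨ ℕ.+-comm k 1 ⟩
      suc k ∎
    -- The outer pieces have lengths at most i and d - (i + k), and all three pieces together must
    -- reach d.
    lower : ∀ i k → i + k ≤ d → i + k ≤ i + dist G (g i) (g (i + k))
    lower i k i+k≤d = ℕ.+-cancelʳ-≤ (d ∸ (i + k)) _ _ (begin
      i + k + (d ∸ (i + k))                             ≡⟨ ℕ.m+[n∸m]≡n i+k≤d ⟩
      d                                                 ≡⟨ cong₂ (dist G) (≡.sym g0) (≡.sym gd) ⟩
      dist G (g 0) (g d)                                ≤⟨ dist-triangle (g 0) (g (i + k)) (g d) ⟩
      dist G (g 0) (g (i + k)) + dist G (g (i + k)) (g d)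
        ≤⟨ ℕ.+-mono-≤ (dist-triangle (g 0) (g i) (g (i + k))) tail ⟩
      dist G (g 0) (g i) + dist G (g i) (g (i + k)) + (d ∸ (i + k))
        ≤⟨ ℕ.+-monoˡ-≤ _ (ℕ.+-monoˡ-≤ _ (along 0 i (ℕ.≤-trans (ℕ.m≤m+n i k) i+k≤d))) ⟩
      i + dist G (g i) (g (i + k)) + (d ∸ (i + k))      ∎)
      where
      tail : dist G (g (i + k)) (g d) ≤ d ∸ (i + k)
      tail = subst (λ j → dist G (g (i + k)) (g j) ≤ d ∸ (i + k)) (ℕ.m+[n∸m]≡n i+k≤d)
        (along (i + k) (d ∸ (i + k)) (ℕ.≤-reflexive (ℕ.m+[n∸m]≡n i+k≤d)))

-- Rank bounds for A + I

M : ∀ {n} → Graph n → Fin n → Fin n → ℤ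
M G u v = δ u v ℤ.+ + eccEntry G u v

M-action : ∀ {n} (G : Graph n) x i →
  ∑ℚ.sum (λ j → ι (M G i j) ℚ.* x j) ≡ x i ℚ.+ sumFin (λ j → eccMatrix G i j ℚ.* x j)
M-action G x i = begin
  ∑ℚ.sum (λ j → ι (M G i j) ℚ.* x j)
    ≡⟨ ∑ℚ.sum-cong-≗ (λ j → ≡.trans (cong (ℚ._* x j) (ι-+ (δ i j) (+ eccEntry G i j)))
         (≡.trans (ℚ.*-distribʳ-+ (x j) (ι (δ i j)) (eccMatrix G i j))
         (cong (ℚ._+ eccMatrix G i j ℚ.* x j) (ℚ.*-comm (ι (δ i j)) (x j))))) ⟩
  ∑ℚ.sum (λ j → x j ℚ.* ι (δ i j) ℚ.+ eccMatrix G i j ℚ.* x j)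
    ≡⟨ ∑ℚ.∑-distrib-+ (λ j → x j ℚ.* ι (δ i j)) (λ j → eccMatrix G i j ℚ.* x j) ⟩
  ∑ℚ.sum (λ j → x j ℚ.* ι (δ i j)) ℚ.+ ∑ℚ.sum (λ j → eccMatrix G i j ℚ.* x j)
    ≡⟨ cong₂ ℚ._+_ (∑-δ x i) (≡.sym (sumFin≡∑ (λ j → eccMatrix G i j ℚ.* x j))) ⟩
  x i ℚ.+ sumFin (λ j → eccMatrix G i j ℚ.* x j) ∎
  where open ≡-Reasoning

Eigen⇒Null : ∀ {n} (G : Graph n) x → IsEigenvector (eccMatrix G) (- 1ℚ) x → Null (M G) x
Eigen⇒Null G x eig i = ≡.trans (M-action G x i) (≡.trans (cong (x i ℚ.+_) (eig i))
  (solve 1 (λ x → x :+ con (- 1ℚ) :* x := con 0ℚ) refl (x i)))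
  where open ℚ-Solver

Null⇒Eigen : ∀ {n} (G : Graph n) x → Null (M G) x → IsEigenvector (eccMatrix G) (- 1ℚ) x
Null⇒Eigen G x null i = begin
  y                           ≡⟨ solve 2 (λ x y → y := con (- 1ℚ) :* x :+ (x :+ y)) refl (x i) y ⟩
  - 1ℚ ℚ.* x i ℚ.+ (x i ℚ.+ y) ≡⟨ cong (- 1ℚ ℚ.* x i ℚ.+_) (≡.trans (≡.sym (M-action G x i)) (null i)) ⟩
  - 1ℚ ℚ.* x i ℚ.+ 0ℚ         ≡⟨ ℚ.+-identityʳ _ ⟩
  - 1ℚ ℚ.* x i                ∎
  where
  open ≡-Reasoning
  open ℚ-Solver
  y = sumFin (λ j → eccMatrix G i j ℚ.* x j)

LinIndep⇒Indep : ∀ {n k} (vs : Fin k → Fin n → ℚ) → LinIndep vs → Indep vs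
LinIndep⇒Indep vs indep c e = indep c (λ j → ≡.trans (sumFin≡∑ (λ i → c i ℚ.* vs i j)) (e j))

Indep⇒LinIndep : ∀ {n k} (vs : Fin k → Fin n → ℚ) → Indep vs → LinIndep vs
Indep⇒LinIndep vs indep c e = indep c (λ j → ≡.trans (≡.sym (sumFin≡∑ (λ i → c i ℚ.* vs i j))) (e j))

-- Partitions of the vertex set

Bijection⊎ : ∀ {n s w} → Fin n ↔ (Fin s ⊎ Fin w) → n ≡ s + w
Bijection⊎ β = Permutation.↔⇒≡ (↔-sym +↔⊎ ↔-∘ β)

Partition : ∀ {n} → (Fin n → Bool) → Set
Partition {n} p = Σ[ s ∈ ℕ ] Σ[ w ∈ ℕ ] Σ[ β ∈ (Fin n ↔ (Fin s ⊎ Fin w)) ]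
  (∀ i → p (Inverse.from β (inj₁ i)) ≡ true) × (∀ j → p (Inverse.from β (inj₂ j)) ≡ false)

partition : ∀ {n} (p : Fin n → Bool) → Partition p
partition {zero}  p = 0 , 0 , mk↔ₛ′ (λ ()) (λ { (inj₁ ()) ; (inj₂ ()) }) (λ { (inj₁ ()) ; (inj₂ ()) }) (λ ()) , (λ ()) , λ ()
partition {suc n} p with partition (p ∘ suc) | p zero in p₀
... | s , w , β , pt , pf | true = suc s , w , mk↔ₛ′ to from to∘from from∘to , (λ { zero → p₀ ; (suc i) → pt i }) , pf
  where
  up : Fin s ⊎ Fin w → Fin (suc s) ⊎ Fin w
  up (inj₁ i) = inj₁ (suc i)
  up (inj₂ j) = inj₂ j
  to : Fin (suc n) → Fin (suc s) ⊎ Fin w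
  to zero    = inj₁ zero
  to (suc i) = up (Inverse.to β i)
  from : Fin (suc s) ⊎ Fin w → Fin (suc n)
  from (inj₁ zero)    = zero
  from (inj₁ (suc i)) = suc (Inverse.from β (inj₁ i))
  from (inj₂ j)       = suc (Inverse.from β (inj₂ j))
  to∘from : ∀ x → to (from x) ≡ x
  to∘from (inj₁ zero)    = refl
  to∘from (inj₁ (suc i)) = cong up (Inverse.strictlyInverseˡ β (inj₁ i))
  to∘from (inj₂ j)       = cong up (Inverse.strictlyInverseˡ β (inj₂ j))
  from-up : ∀ x → from (up x) ≡ suc (Inverse.from β x)
  from-up (inj₁ i) = refl
  from-up (inj₂ j) = refl
  from∘to : ∀ i → from (to i) ≡ i
  from∘to zero    = refl
  from∘to (suc i) = ≡.trans (from-up (Inverse.to β i)) (cong suc (Inverse.strictlyInverseʳ β i))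
... | s , w , β , pt , pf | false = s , suc w , mk↔ₛ′ to from to∘from from∘to , pt , (λ { zero → p₀ ; (suc j) → pf j })
  where
  up : Fin s ⊎ Fin w → Fin s ⊎ Fin (suc w)
  up (inj₁ i) = inj₁ i
  up (inj₂ j) = inj₂ (suc j)
  to : Fin (suc n) → Fin s ⊎ Fin (suc w)
  to zero    = inj₂ zero
  to (suc i) = up (Inverse.to β i)
  from : Fin s ⊎ Fin (suc w) → Fin (suc n)
  from (inj₁ i)       = suc (Inverse.from β (inj₁ i))
  from (inj₂ zero)    = zero
  from (inj₂ (suc j)) = suc (Inverse.from β (inj₂ j))
  to∘from : ∀ x → to (from x) ≡ x
  to∘from (inj₁ i)       = cong up (Inverse.strictlyInverseˡ β (inj₁ i))
  to∘from (inj₂ zero)    = refl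
  to∘from (inj₂ (suc j)) = cong up (Inverse.strictlyInverseˡ β (inj₂ j))
  from-up : ∀ x → from (up x) ≡ suc (Inverse.from β x)
  from-up (inj₁ i) = refl
  from-up (inj₂ j) = refl
  from∘to : ∀ i → from (to i) ≡ i
  from∘to zero    = refl
  from∘to (suc i) = ≡.trans (from-up (Inverse.to β i)) (cong suc (Inverse.strictlyInverseʳ β i))

Injective : ∀ {k n} → (Fin k → Fin n) → Set
Injective f = ∀ i j → f i ≡ f j → i ≡ j

from-injective : ∀ {n} {A : Set} (β : Fin n ↔ A) {x y} → Inverse.from β x ≡ Inverse.from β y → x ≡ y
from-injective β {x} {y} e =
  ≡.trans (≡.sym (Inverse.strictlyInverseˡ β x)) (≡.trans (cong (Inverse.to β) e) (Inverse.strictlyInverseˡ β y))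

δ-injective : ∀ {k n} {f : Fin k → Fin n} → Injective f → ∀ i j → δ (f i) (f j) ≡ δ i j
δ-injective {f = f} inj i j with i ≟ j
... | yes refl = ≡.trans (δ-refl (f i)) (≡.sym (δ-refl i))
... | no i≢j   = ≡.trans (δ-≢ (i≢j ∘ inj i j)) (≡.sym (δ-≢ i≢j))

-- Writing the larger index as `i + suc k` matches the form in which `geodesic` supplies distances;
-- symmetry covers the entries below the diagonal.
identity-entries : ∀ {e} (F : ℕ → ℕ → ℤ) → (∀ i → F i i ≡ 1ℤ) → (∀ i j → F i j ≡ F j i) →
  (∀ i k → i + suc k < e → F i (i + suc k) ≡ 0ℤ) → ∀ (i j : Fin e) → δ i j ≡ F (toℕ i) (toℕ j)
identity-entries {e} F F-refl F-sym F-off i j = by-order (ℕ.<-cmp (toℕ i) (toℕ j))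
  where
  above : ∀ i j → i < j → j < e → F i j ≡ 0ℤ
  above i j i<j j<e with ℕ.m≤n⇒∃[o]m+o≡n i<j
  ... | k , refl rewrite ≡.sym (ℕ.+-suc i k) = F-off i k j<e
  by-order : Tri (toℕ i < toℕ j) (toℕ i ≡ toℕ j) (toℕ j < toℕ i) → δ i j ≡ F (toℕ i) (toℕ j)
  by-order (tri< i<j i≢j _) = ≡.trans (δ-≢ (i≢j ∘ cong toℕ)) (≡.sym (above (toℕ i) (toℕ j) i<j (Fin.toℕ<n j)))
  by-order (tri≈ _ i≡j _) with refl ← Fin.toℕ-injective {i = i} {j} i≡j = ≡.trans (δ-refl i) (≡.sym (F-refl (toℕ i)))
  by-order (tri> _ i≢j j<i) = ≡.trans (δ-≢ (i≢j ∘ cong toℕ))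
    (≡.sym (≡.trans (F-sym (toℕ i) (toℕ j)) (above (toℕ j) (toℕ i) j<i (Fin.toℕ<n i))))

-- The classes are A, then B outside A, then the rest, so that `total` is an exact count even when A
-- and B overlap.
record ThreeClasses {n} (A B : Fin n → Set) : Set where
  field
    a b w : ℕ
    f : Fin a → Fin n
    g : Fin b → Fin n
    h : Fin w → Fin n
    f-inj : Injective f
    g-inj : Injective g
    h-inj : Injective h
    f-holds : ∀ i → A (f i)
    g-holds : ∀ i → B (g i)
    rest    : ∀ i → ¬ A (h i) × ¬ B (h i)
    total   : n ≡ a + b + w

threeClasses : ∀ {n} {A B : Fin n → Set} → (∀ v → Dec (A v)) → (∀ v → Dec (B v)) → ThreeClasses A B
threeClasses A? B? with partition (λ v → ⌊ A? v ⌋)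
... | a , w , β , At , Af with partition (λ j → ⌊ B? (Inverse.from β (inj₂ j)) ⌋)
... | b , w′ , γ , Bt , Bf = record
  { f = λ i → Inverse.from β (inj₁ i)
  ; g = λ i → Inverse.from β (inj₂ (Inverse.from γ (inj₁ i)))
  ; h = λ i → Inverse.from β (inj₂ (Inverse.from γ (inj₂ i)))
  ; f-inj = λ i j e → inj₁-injective (from-injective β e)
  ; g-inj = λ i j e → inj₁-injective (from-injective γ (inj₂-injective (from-injective β e)))
  ; h-inj = λ i j e → inj₂-injective (from-injective γ (inj₂-injective (from-injective β e)))
  ; f-holds = λ i → isYes (A? _) (At i)
  ; g-holds = λ i → isYes (B? _) (Bt i)
  ; rest  = λ i → isNo (A? _) (Af (Inverse.from γ (inj₂ i))) , isNo (B? _) (Bf i)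
  ; total = ≡.trans (Bijection⊎ β) (≡.trans (cong (λ x → a + x) (Bijection⊎ γ)) (≡.sym (ℕ.+-assoc a b w′)))
  }
  where
  isYes : ∀ {A : Set} (d : Dec A) → ⌊ d ⌋ ≡ true → A
  isYes (yes a) _ = a
  isNo : ∀ {A : Set} (d : Dec A) → ⌊ d ⌋ ≡ false → ¬ A
  isNo (no ¬a) _ = ¬a

∣-⊓ : ∀ {k a b} → k ∣ a → k ∣ b → k ∣ a ℕ.⊓ b
∣-⊓ {k} {a} {b} k∣a k∣b with ℕ.⊓-sel a b
... | inj₁ e = subst (k ∣_) (≡.sym e) k∣a
... | inj₂ e = subst (k ∣_) (≡.sym e) k∣b

-- Bounds relating the multiplicity to submatrices and null vectors

module Multiplicity {n} (G : Graph n) (conn : Connected G) {m} (mult : HasEigMult (eccMatrix G) (- 1ℚ) m) where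
  open Distance G conn

  rank≥ : ∀ {k} (f : Fin k → Fin n) → TrivialKernel (λ i j → M G (f i) (f j)) → m + k ≤ n
  rank≥ = nullity+rank≤ (M G) (proj₁ (proj₁ mult)) (λ i → Eigen⇒Null G (proj₁ (proj₁ mult) i) (proj₁ (proj₂ (proj₁ mult)) i))
    (LinIndep⇒Indep (proj₁ (proj₁ mult)) (proj₂ (proj₂ (proj₁ mult))))

  nullity≥ : ∀ {k} (vs : Fin k → Fin n → ℚ) → (∀ i → Null (M G) (vs i)) → (f : Fin k → Fin n) →
    (∀ i → vs i (f i) ≢ 0ℚ) → (∀ i j → i ≢ j → vs i (f j) ≡ 0ℚ) → k ≤ m
  nullity≥ {k} vs null f diag off = ℕ.≮⇒≥ too-many
    where
    too-many : ¬ (m < k)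
    -- Any `suc m` of the vectors are still in diagonal position, hence independent, which the
    -- maximality half of `HasEigMult` forbids.
    too-many m<k = proj₂ mult (vs ∘ r) (λ i → Null⇒Eigen G (vs (r i)) (null (r i)))
      (Indep⇒LinIndep (vs ∘ r) (diagonal⇒Indep (vs ∘ r) (f ∘ r) (λ i → diag (r i)) (λ i j i≢j → off (r i) (r j) (i≢j ∘ r-injective i j))))
      where
      r : Fin (suc m) → Fin k
      r i = inject≤ i m<k
      r-injective : ∀ i j → r i ≡ r j → i ≡ j
      r-injective i j = Fin.inject≤-injective m<k m<k i j

  ∣ecc⇒rank≥ : ∀ k → 2 ≤ k → ∀ {w} (f : Fin w → Fin n) → Injective f → (∀ i → k ∣ ecc G (f i)) → m + w ≤ n
  ∣ecc⇒rank≥ k 2≤k {w} f inj k∣ecc = rank≥ f (I+kQ-trivialKernel k 2≤k _ (λ i j → + quotient i j) (λ i j →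
    cong₂ ℤ._+_ (δ-injective inj i j) (≡.trans (cong +_ (≡.trans (_∣_.equality (k∣entry i j)) (ℕ.*-comm (quotient i j) k))) (ℤ.pos-* k (quotient i j)))))
    where
    -- A nonzero entry is the minimum of two eccentricities, both divisible by `k`.
    k∣entry : ∀ i j → k ∣ eccEntry G (f i) (f j)
    k∣entry i j = [ divides 0 , (λ (e , e′) → subst (k ∣_) (≡.sym (≡.trans e e′)) (∣-⊓ (k∣ecc i) (k∣ecc j))) ]′
      (eccEntry-values (f i) (f j))
    quotient : Fin w → Fin w → ℕ
    quotient i j = _∣_.quotient (k∣entry i j)

  -- Along a geodesic v = g 0, …, g e only the entries involving v can be nonzero off the diagonal, once g e is dropped.
  dist≤rank : (∀ u → 2 ≤ ecc G u) → ∀ {v u e} → dist G v u ≡ suc e → m + suc e ≤ n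
  dist≤rank 2≤ecc {v} {u} {e} d≡ = rank≥ f (TrivialKernel-cong entries (star-trivialKernel a a≢1))
    where
    g = proj₁ (geodesic v u)
    geo′ : ∀ i k → i + k ≤ suc e → dist G (g i) (g (i + k)) ≡ k
    geo′ i k le = proj₂ (proj₂ (proj₂ (geodesic v u))) i k (subst (i + k ≤_) (≡.sym d≡) le)
    f : Fin (suc e) → Fin n
    f i = g (toℕ i)
    a : Fin e → ℕ
    a j = eccEntry G (g 0) (g (suc (toℕ j)))
    -- A nonzero entry is a minimum of eccentricities, hence at least 2. Here radius at least 2
    -- keeps the star nonsingular.
    a≢1 : ∀ j → a j ≢ 1
    a≢1 j a≡1 = [ (λ a≡0 → contradiction (≡.trans (≡.sym a≡0) a≡1) λ ()) ,
      (λ (x , y) → ℕ.<⇒≢ (ℕ.⊓-glb (2≤ecc (g 0)) (2≤ecc (g (suc (toℕ j))))) (≡.sym (≡.trans (≡.sym y) (≡.trans (≡.sym x) a≡1)))) ]′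
      (eccEntry-values (g 0) (g (suc (toℕ j))))
    g-≢ : ∀ i k → i + suc k ≤ suc e → g i ≢ g (i + suc k)
    g-≢ i k le gi≡ = contradiction
      (≡.trans (≡.sym (dist-refl (g i))) (≡.trans (cong (dist G (g i)) gi≡) (geo′ i (suc k) le))) λ ()
    -- Prolonging the segment forwards to `g (suc e)` and backwards to `g 0` shows that both of its
    -- ends have eccentricity above its length. The forward part needs the strict bound, hence the
    -- dropped last vertex.
    near : ∀ i k → suc i + k < suc e → eccEntry G (g (suc i)) (g (suc i + k)) ≡ 0
    near i k lt = eccEntry-near (ℕ.<-≤-trans left (dist≤ecc′ _ (g (suc e)))) (ℕ.<-≤-trans right (dist≤ecc (g 0) _))
      where
      open ℕ.≤-Reasoning
      d = dist G (g (suc i)) (g (suc i + k))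
      d≡k : d ≡ k
      d≡k = geo′ (suc i) k (ℕ.<⇒≤ lt)
      i<e : suc i ≤ suc e
      i<e = ℕ.≤-trans (ℕ.m≤m+n (suc i) k) (ℕ.<⇒≤ lt)
      rest : suc i + (suc e ∸ suc i) ≡ suc e
      rest = ℕ.m+[n∸m]≡n i<e
      left : d < dist G (g (suc i)) (g (suc e))
      left = begin-strict
        d               ≡⟨ d≡k ⟩
        k               <⟨ ℕ.+-cancelˡ-< (suc i) k (suc e ∸ suc i) (subst (suc i + k <_) (≡.sym rest) lt) ⟩
        suc e ∸ suc i   ≡⟨ ≡.sym (geo′ (suc i) (suc e ∸ suc i) (ℕ.≤-reflexive rest)) ⟩
        dist G (g (suc i)) (g (suc i + (suc e ∸ suc i)))  ≡⟨ cong (λ j → dist G (g (suc i)) (g j)) rest ⟩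
        dist G (g (suc i)) (g (suc e))  ∎
      right : d < dist G (g 0) (g (suc i + k))
      right = begin-strict
        d               ≡⟨ d≡k ⟩
        k               <⟨ ℕ.m≤n+m (suc k) i ⟩
        i + suc k       ≡⟨ ℕ.+-suc i k ⟩
        suc i + k       ≡⟨ ≡.sym (geo′ 0 (suc i + k) (ℕ.<⇒≤ lt)) ⟩
        dist G (g 0) (g (suc i + k)) ∎
    Entry : ℕ → ℕ → ℤ
    Entry i j = M G (g i) (g j)
    Entry-sym : ∀ i j → Entry i j ≡ Entry j i
    Entry-sym i j = cong₂ (λ x y → x ℤ.+ + y) (δ-sym (g i) (g j)) (eccEntry-sym (g i) (g j))
    Entry-refl : ∀ i → Entry i i ≡ 1ℤ
    Entry-refl i = cong₂ (λ x y → x ℤ.+ + y) (δ-refl (g i)) (eccEntry-refl (g i))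
    Entry-zero : ∀ j → j < e → + eccEntry G (g 0) (g (suc j)) ≡ Entry 0 (suc j)
    Entry-zero j j<e = ≡.sym (≡.trans (cong (ℤ._+ + eccEntry G (g 0) (g (suc j))) (δ-≢ (g-≢ 0 j (s≤s (ℕ.<⇒≤ j<e))))) (ℤ.+-identityˡ _))
    Entry-< : ∀ i k → i + suc k < e → Entry (suc i) (suc (i + suc k)) ≡ 0ℤ
    Entry-< i k lt = cong₂ (λ x y → x ℤ.+ + y) (δ-≢ (g-≢ (suc i) k (s≤s (ℕ.<⇒≤ lt)))) (near i (suc k) (s≤s lt))
    entries : ∀ i j → star a i j ≡ M G (f i) (f j)
    entries zero    zero    = ≡.sym (Entry-refl 0)
    entries zero    (suc j) = Entry-zero (toℕ j) (Fin.toℕ<n j)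
    entries (suc i) zero    = ≡.trans (Entry-zero (toℕ i) (Fin.toℕ<n i)) (Entry-sym 0 (suc (toℕ i)))
    entries (suc i) (suc j) = identity-entries (λ i j → Entry (suc i) (suc j)) (λ i → Entry-refl (suc i))
      (λ i j → Entry-sym (suc i) (suc j)) Entry-< i j

  ecc≤rank : (∀ u → 2 ≤ ecc G u) → ∀ v → m + ecc G v ≤ n
  ecc≤rank 2≤ecc v = from-dist (ecc G v) (proj₂ (ecc-attained v)) (2≤ecc v)
    where
    from-dist : ∀ e → dist G v (proj₁ (ecc-attained v)) ≡ e → 2 ≤ e → m + e ≤ n
    from-dist (suc e) d≡ _ = dist≤rank 2≤ecc d≡

  -- The vertices of eccentricity prime to 6 escape the two divisor classes, each of which has at most r elements.
  sieve : ∀ {r} → m + r ≡ n → Σ[ w ∈ ℕ ] Σ[ f ∈ (Fin w → Fin n) ] Injective f × n ≤ r + r + w ×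
    (∀ i → ¬ (2 ∣ ecc G (f i)) × ¬ (3 ∣ ecc G (f i)))
  sieve {r} m+r≡n = w , h , h-inj , n≤ , rest
    where
    open ThreeClasses (threeClasses (λ v → 2 ∣? ecc G v) (λ v → 3 ∣? ecc G v))
    ≤r : ∀ c → m + c ≤ n → c ≤ r
    ≤r c m+c≤n = ℕ.+-cancelˡ-≤ m c r (subst (m + c ≤_) (≡.sym m+r≡n) m+c≤n)
    n≤ : n ≤ r + r + w
    n≤ = subst (_≤ r + r + w) (≡.sym total) (ℕ.+-monoˡ-≤ w (ℕ.+-mono-≤
      (≤r a (∣ecc⇒rank≥ 2 ℕ.≤-refl f f-inj f-holds)) (≤r b (∣ecc⇒rank≥ 3 (s≤s (s≤s z≤n)) g g-inj g-holds))))

-- Joins with a complete graph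

joinAdj : ∀ {s w} → Graph w → Fin s ⊎ Fin w → Fin s ⊎ Fin w → Bool
joinAdj H (inj₂ i) (inj₂ j) = adj H i j
joinAdj H (inj₁ _) _        = true
joinAdj H (inj₂ _) (inj₁ _) = true

-- The join seen through a sum type, without arithmetic on `Fin (s + w)`. Only distinct vertices are
-- compared, so `joinAdj` may be true on the diagonal of the clique.
JoinForm : ∀ {n w} → Graph n → ℕ → Graph w → Set
JoinForm {n} {w} G s H = Σ[ β ∈ (Fin n ↔ (Fin s ⊎ Fin w)) ]
  ∀ u v → u ≢ v → adj G u v ≡ joinAdj H (Inverse.to β u) (Inverse.to β v)

K-adj : ∀ {s} {i j : Fin s} → i ≢ j → adj (K s) i j ≡ true
K-adj {i = i} {j} i≢j with i ≟ j
... | yes i≡j = contradiction i≡j i≢j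
... | no _    = refl

∨G-adj : ∀ s {w} (H : Graph w) {x y} → x ≢ y → adj (K s ∨G H) x y ≡ joinAdj H (splitAt s x) (splitAt s y)
∨G-adj s {w} H {x} {y} x≢y with x ≟ y
... | yes x≡y = contradiction x≡y x≢y
... | no _ with splitAt s x in ex | splitAt s y in ey
... | inj₁ i | inj₂ j = refl
... | inj₂ i | inj₁ j = refl
... | inj₂ i | inj₂ j = ≡.trans (cong (adj H i j ∨_) (Graph.sym H j i)) (∨-idem (adj H i j))
... | inj₁ i | inj₁ j = ∨-trueˡ (K-adj λ i≡j →
        x≢y (≡.trans (≡.sym (Fin.splitAt⁻¹-↑ˡ ex)) (≡.trans (cong (Fin._↑ˡ w) i≡j) (Fin.splitAt⁻¹-↑ˡ ey))))

to-injective : ∀ {n} {A : Set} (β : Fin n ↔ A) {x y} → Inverse.to β x ≡ Inverse.to β y → x ≡ y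
to-injective β {x} {y} e =
  ≡.trans (≡.sym (Inverse.strictlyInverseʳ β x)) (≡.trans (cong (Inverse.from β) e) (Inverse.strictlyInverseʳ β y))

≅⇒JoinForm : ∀ {n s w} {G : Graph n} {H : Graph w} → G ≅ (K s ∨G H) → JoinForm G s H
≅⇒JoinForm {s = s} {H = H} (f , f-adj) = (+↔⊎ ↔-∘ f) , λ u v u≢v →
  ≡.trans (f-adj u v) (∨G-adj s H (u≢v ∘ to-injective f))

JoinForm⇒≅ : ∀ {n s w} {G : Graph n} {H : Graph w} → JoinForm G s H → G ≅ (K s ∨G H)
JoinForm⇒≅ {n} {s} {w} {G} {H} (β , β-adj) = f , f-adj
  where
  f : Fin n ↔ Fin (s + w)
  f = ↔-sym +↔⊎ ↔-∘ β
  f-adj : ∀ u v → adj G u v ≡ adj (K s ∨G H) (Inverse.to f u) (Inverse.to f v)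
  f-adj u v with u ≟ v
  ... | yes refl = ≡.trans (irrefl G u) (≡.sym (irrefl (K s ∨G H) (Inverse.to f u)))
  ... | no u≢v = ≡.trans (β-adj u v u≢v) (≡.sym (≡.trans (∨G-adj s H (u≢v ∘ to-injective f))
                   (cong₂ (joinAdj H) (Fin.splitAt-join s w (Inverse.to β u)) (Fin.splitAt-join s w (Inverse.to β v)))))

-- The principal submatrix of A + I on one vertex of K s and all of H, in K s ∨G H.
bordered : ∀ {w} → (Fin w → Fin w → Bool) → Fin (suc w) → Fin (suc w) → ℤ
bordered h zero    _       = 1ℤ
bordered h (suc i) zero    = 1ℤ
bordered h (suc i) (suc j) = if ⌊ i ≟ j ⌋ then 1ℤ else (if h i j then 0ℤ else + 2)

bordered-zeroʳ : ∀ {w} (h : Fin w → Fin w → Bool) x → bordered h x zero ≡ 1ℤ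
bordered-zeroʳ h zero    = refl
bordered-zeroʳ h (suc x) = refl

bordered-refl : ∀ {w} (h : Fin w → Fin w → Bool) x → bordered h x x ≡ 1ℤ
bordered-refl h zero = refl
bordered-refl h (suc i) with i ≟ i
... | yes _  = refl
... | no i≢i = contradiction refl i≢i

bordered-≢ : ∀ {w} (h : Fin w → Fin w → Bool) {i j b} → i ≢ j → h i j ≡ b →
  bordered h (suc i) (suc j) ≡ (if b then 0ℤ else + 2)
bordered-≢ h {i} {j} i≢j refl with i ≟ j
... | yes i≡j = contradiction i≡j i≢j
... | no _    = refl

NoUniversal : ∀ {w} → Graph w → Set
NoUniversal H = ∀ i → ∃ λ j → i ≢ j × adj H i j ≡ false

module Universal {n} (G : Graph n) (conn : Connected G) (z : Fin n) (z-univ : ∀ v → z ≢ v → adj G z v ≡ true) where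
  open Distance G conn

  dist-universal : ∀ u → (∀ v → u ≢ v → adj G u v ≡ true) → ∀ v → dist G u v ≤ 1
  dist-universal u univ v = by-eq (u ≟ v)
    where
    by-eq : Dec (u ≡ v) → dist G u v ≤ 1
    by-eq (yes refl) = ℕ.≤-trans (ℕ.≤-reflexive (dist-refl u)) z≤n
    by-eq (no u≢v)   = ℕ.≤-reflexive (adj⇒dist≡1 (univ v u≢v))

  entry-universal : ∀ u v → (∀ v → u ≢ v → adj G u v ≡ true) → u ≢ v → eccEntry G u v ≡ 1
  entry-universal u v univ u≢v = eccEntry-far d≡1 (≡.trans (cong (ℕ._⊓ ecc G v) ecc-u) (ℕ.m≤n⇒m⊓n≡m 1≤ecc-v))
    where
    d≡1 : dist G u v ≡ 1
    d≡1 = adj⇒dist≡1 (univ v u≢v)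
    1≤ecc-v : 1 ≤ ecc G v
    1≤ecc-v = subst (_≤ ecc G v) d≡1 (dist≤ecc u v)
    ecc-u : ecc G u ≡ 1
    ecc-u = ℕ.≤-antisym (maxFin-least (λ x → dist G x u) (λ x → subst (_≤ 1) (dist-sym u x) (dist-universal u univ x)))
      (subst (_≤ ecc G u) d≡1 (dist≤ecc′ u v))

  -- A detour through the universal vertex `z` bounds all distances by 2, and a non-neighbour
  -- attains 2.
  ecc≡2 : ∀ u v → u ≢ v → adj G u v ≡ false → ecc G u ≡ 2
  ecc≡2 u v u≢v ¬a = ℕ.≤-antisym
    (maxFin-least (λ x → dist G x u) (λ x → ℕ.≤-trans (dist-triangle x z u)
      (ℕ.+-mono-≤ (subst (_≤ 1) (dist-sym z x) (dist-universal z z-univ x)) (dist-universal z z-univ u))))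
    (ℕ.≤-trans (¬adj⇒2≤dist u≢v ¬a) (dist≤ecc′ u v))

  entry-adj : ∀ {u v} → ecc G u ≡ 2 → ecc G v ≡ 2 → adj G u v ≡ true → eccEntry G u v ≡ 0
  entry-adj {u} {v} eu ev a = eccEntry-near (1<2 eu) (1<2 ev)
    where
    1<2 : ∀ {e} → e ≡ 2 → dist G u v < e
    1<2 e≡2 = subst₂ _<_ (≡.sym (adj⇒dist≡1 a)) (≡.sym e≡2) ℕ.≤-refl

  entry-nonadj : ∀ {u v} → ecc G u ≡ 2 → ecc G v ≡ 2 → u ≢ v → adj G u v ≡ false → eccEntry G u v ≡ 2
  entry-nonadj {u} {v} eu ev u≢v ¬a = eccEntry-far
    (ℕ.≤-antisym (subst (dist G u v ≤_) ev (dist≤ecc u v)) (¬adj⇒2≤dist u≢v ¬a)) (cong₂ ℕ._⊓_ eu ev)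

pair : ∀ {A : Set} → A → A → Fin 2 → A
pair x y zero    = x
pair x y (suc _) = y

unit-value : ∀ {n k} (f : Fin k → Fin n) z v →
  comb (unitVectors f) (ι ∘ z) v ≡ ι (∑ℤ.sum (λ j → z j ℤ.* δ (f j) v))
unit-value f z v = ≡.trans (∑ℚ.sum-cong-≗ (λ j → ≡.sym (ι-* (z j) (δ (f j) v)))) (≡.sym (ι-∑ (λ j → z j ℤ.* δ (f j) v)))

module JoinRank {n s w} (G : Graph n) (conn : Connected G) {m} (mult : HasEigMult (eccMatrix G) (- 1ℚ) m)
  (H : Graph w) (noUniv : NoUniversal H) (form : JoinForm G (suc s) H) where
  open Multiplicity G conn mult
  β = proj₁ form
  open Inverse β using (to; from; strictlyInverseˡ; strictlyInverseʳ)

  n≡ : n ≡ suc s + w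
  n≡ = Bijection⊎ β

  U : Fin (suc s) → Fin n
  U i = from (inj₁ i)
  W : Fin w → Fin n
  W j = from (inj₂ j)

  adj-to : ∀ {u v x y} → u ≢ v → to u ≡ x → to v ≡ y → adj G u v ≡ joinAdj H x y
  adj-to u≢v refl refl = proj₂ form _ _ u≢v

  universal : ∀ {u i} → to u ≡ inj₁ i → ∀ v → u ≢ v → adj G u v ≡ true
  universal u≡ v u≢v = adj-to u≢v u≡ refl

  open Universal G conn (U zero) (universal (strictlyInverseˡ (inj₁ zero)))

  -- A + I factors through this map: all clique vertices have the same row, so one of them can
  -- represent the whole clique.
  class : Fin (suc s) ⊎ Fin w → Fin (suc w)
  class (inj₁ _) = zero
  class (inj₂ j) = suc j

  ecc-W : ∀ {u j} → to u ≡ inj₂ j → ecc G u ≡ 2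
  ecc-W {u} {j} u≡ with noUniv j
  ... | k , j≢k , ¬a = ecc≡2 u (W k) u≢Wk (≡.trans (adj-to u≢Wk u≡ (strictlyInverseˡ (inj₂ k))) ¬a)
    where
    u≢Wk : u ≢ W k
    u≢Wk u≡Wk = j≢k (inj₂-injective (≡.trans (≡.sym u≡) (≡.trans (cong to u≡Wk) (strictlyInverseˡ (inj₂ k)))))

  offDiagonal : ∀ u v → u ≢ v → ∀ x y → to u ≡ x → to v ≡ y → + eccEntry G u v ≡ bordered (adj H) (class x) (class y)
  offDiagonal u v u≢v (inj₁ i) y        u≡ v≡ = cong +_ (entry-universal u v (universal u≡) u≢v)
  offDiagonal u v u≢v (inj₂ i) (inj₁ j) u≡ v≡ =
    cong +_ (≡.trans (Distance.eccEntry-sym G conn u v) (entry-universal v u (universal v≡) (u≢v ∘ ≡.sym)))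
  offDiagonal u v u≢v (inj₂ i) (inj₂ j) u≡ v≡ = by-adj (adj H i j) refl
    where
    i≢j : i ≢ j
    i≢j i≡j = u≢v (to-injective β (≡.trans u≡ (≡.trans (cong inj₂ i≡j) (≡.sym v≡))))
    by-adj : ∀ b → adj H i j ≡ b → + eccEntry G u v ≡ bordered (adj H) (suc i) (suc j)
    by-adj true  e = ≡.trans (cong +_ (entry-adj (ecc-W u≡) (ecc-W v≡) (≡.trans (adj-to u≢v u≡ v≡) e)))
                       (≡.sym (bordered-≢ (adj H) i≢j e))
    by-adj false e = ≡.trans (cong +_ (entry-nonadj (ecc-W u≡) (ecc-W v≡) u≢v (≡.trans (adj-to u≢v u≡ v≡) e)))
                       (≡.sym (bordered-≢ (adj H) i≢j e))

  M≡bordered : ∀ u v x y → to u ≡ x → to v ≡ y → M G u v ≡ bordered (adj H) (class x) (class y)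
  M≡bordered u v x y u≡ v≡ = by-eq (u ≟ v)
    where
    by-eq : Dec (u ≡ v) → M G u v ≡ bordered (adj H) (class x) (class y)
    by-eq (no u≢v)   = ≡.trans (cong (ℤ._+ + eccEntry G u v) (δ-≢ u≢v))
                         (≡.trans (ℤ.+-identityˡ _) (offDiagonal u v u≢v x y u≡ v≡))
    by-eq (yes refl) = ≡.trans (cong₂ (λ a b → a ℤ.+ + b) (δ-refl u) (Distance.eccEntry-refl G conn u))
      (≡.sym (≡.trans (cong (λ y → bordered (adj H) (class x) (class y)) (≡.trans (≡.sym v≡) u≡)) (bordered-refl (adj H) (class x))))

  rep : Fin (suc w) → Fin n
  rep zero    = U zero
  rep (suc j) = W j

  M-rep : ∀ u x → M G u (rep x) ≡ bordered (adj H) (class (to u)) x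
  M-rep u zero    = M≡bordered u (U zero) (to u) (inj₁ zero) refl (strictlyInverseˡ (inj₁ zero))
  M-rep u (suc j) = M≡bordered u (W j) (to u) (inj₂ j) refl (strictlyInverseˡ (inj₂ j))

  class-rep : ∀ x → class (to (rep x)) ≡ x
  class-rep zero    = cong class (strictlyInverseˡ (inj₁ zero))
  class-rep (suc j) = cong class (strictlyInverseˡ (inj₂ j))

  rep-injective : Injective rep
  rep-injective x y e = ≡.trans (≡.sym (class-rep x)) (≡.trans (cong (class ∘ to) e) (class-rep y))

  -- All vertices of `H` have eccentricity 2, so their block is I modulo 2. Singularity of
  -- `bordered` therefore costs only one unit of rank.
  rank≥w : m + w ≤ n
  rank≥w = ∣ecc⇒rank≥ 2 ℕ.≤-refl W (λ i j e → inj₂-injective (from-injective β e))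
    (λ j → subst (2 ∣_) (≡.sym (ecc-W (strictlyInverseˡ (inj₂ j)))) (divides 1 refl))

  rank≥1+w : TrivialKernel (bordered (adj H)) → m + suc w ≤ n
  rank≥1+w triv = rank≥ rep (TrivialKernel-cong
    (λ x y → ≡.sym (≡.trans (M-rep (rep x) y) (cong (λ z → bordered (adj H) z y) (class-rep x)))) triv)

  -- A null vector, because every clique column of A + I is constantly 1.
  difference : Fin s → Fin n → ℚ
  difference i = comb (unitVectors (pair (U (suc i)) (U zero))) (ι ∘ pair 1ℤ ℤ.-1ℤ)

  U-≢ : ∀ {i j} → i ≢ j → U i ≢ U j
  U-≢ i≢j e = i≢j (inj₁-injective (from-injective β e))

  M-U : ∀ u i → M G u (U i) ≡ 1ℤ
  M-U u i = ≡.trans (M≡bordered u (U i) (to u) (inj₁ i) refl (strictlyInverseˡ (inj₁ i))) (bordered-zeroʳ (adj H) (class (to u)))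

  difference-null : ∀ i → Null (M G) (difference i)
  difference-null i = Null-unit {N = M G} (pair (U (suc i)) (U zero)) (pair 1ℤ ℤ.-1ℤ) (λ u →
    cong₂ (λ x y → 1ℤ ℤ.* x ℤ.+ (ℤ.-1ℤ ℤ.* y ℤ.+ 0ℤ)) (M-U u (suc i)) (M-U u zero))

  difference-value : ∀ i v {a b} → δ (U (suc i)) v ≡ a → δ (U zero) v ≡ b →
    difference i v ≡ ι (1ℤ ℤ.* a ℤ.+ (ℤ.-1ℤ ℤ.* b ℤ.+ 0ℤ))
  difference-value i v refl refl = unit-value (pair (U (suc i)) (U zero)) (pair 1ℤ ℤ.-1ℤ) v

  difference-diagonal : ∀ i → difference i (U (suc i)) ≢ 0ℚ
  difference-diagonal i e with () ← ≡.trans (≡.sym (difference-value i (U (suc i)) (δ-refl (U (suc i))) (δ-≢ (U-≢ λ ())))) e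

  difference-off : ∀ i j → i ≢ j → difference i (U (suc j)) ≡ 0ℚ
  difference-off i j i≢j = difference-value i (U (suc j)) (δ-≢ (U-≢ (i≢j ∘ Fin.suc-injective))) (δ-≢ (U-≢ λ ()))

  s≤m : s ≤ m
  s≤m = nullity≥ difference difference-null (U ∘ suc) difference-diagonal difference-off

  1+s≤m : (z : Fin (suc w) → ℤ) → (∀ x → ∑ℤ.sum (λ y → z y ℤ.* bordered (adj H) x y) ≡ 0ℤ) →
    ∀ k → z (suc k) ≢ 0ℤ → suc s ≤ m
  1+s≤m z z-null k zk≢0 = nullity≥ vs vs-null f diag off
    where
    extended : Fin n → ℚ
    extended = comb (unitVectors rep) (ι ∘ z)
    vs : Fin (suc s) → Fin n → ℚ
    vs zero    = extended
    vs (suc i) = difference i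
    f : Fin (suc s) → Fin n
    -- The differences vanish on `H`, and `extended` vanishes on the clique outside `U zero`. Hence
    -- these test coordinates are diagonal, and a nonzero entry of `z` on the `H` part is required.
    f zero    = W k
    f (suc i) = U (suc i)
    vs-null : ∀ i → Null (M G) (vs i)
    vs-null (suc i) = difference-null i
    vs-null zero    = Null-unit {N = M G} rep z (λ u →
      ≡.trans (∑ℤ.sum-cong-≗ (λ y → cong (z y ℤ.*_) (M-rep u y))) (z-null (class (to u))))
    W≢U : ∀ {i} j → W i ≢ U j
    W≢U j e with () ← from-injective β e
    extended-W : extended (W k) ≡ ι (z (suc k))
    extended-W = ≡.trans (unit-value rep z (W k)) (cong ι (≡.trans (∑ℤ.sum-cong-≗ (λ y → ≡.trans (cong (z y ℤ.*_)
      (≡.trans (δ-injective rep-injective y (suc k)) (δ-sym y (suc k)))) (ℤ.*-comm (z y) (δ (suc k) y)))) (∑ℤ-δ (suc k) z)))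
    diag : ∀ i → vs i (f i) ≢ 0ℚ
    diag (suc i) = difference-diagonal i
    diag zero    = λ e → zk≢0 (ι-injective (≡.trans (≡.sym extended-W) e))
    off : ∀ i j → i ≢ j → vs i (f j) ≡ 0ℚ
    off zero    zero    0≢0 = contradiction refl 0≢0
    off (suc i) (suc j) i≢j = difference-off i j (i≢j ∘ cong suc)
    off (suc i) zero    _   = difference-value i (W k) (δ-≢ (λ e → W≢U (suc i) (≡.sym e))) (δ-≢ (λ e → W≢U zero (≡.sym e)))
    off zero    (suc j) _   = ≡.trans (unit-value rep z (U (suc j))) (cong ι (∑ℤ-zero (λ y →
      ≡.trans (cong (z y ℤ.*_) (δ-≢ (rep≢U y))) (ℤ.*-zeroʳ (z y)))))
      where
      rep≢U : ∀ y → rep y ≢ U (suc j)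
      rep≢U zero    e = U-≢ (λ ()) e
      rep≢U (suc i) e = W≢U (suc j) e

  -- The s differences and the `suc w` representatives add up to n = suc s + w, so both bounds are
  -- sharp. In the singular case one unit moves from the rank to the nullity.
  corank-nonsingular : TrivialKernel (bordered (adj H)) → m + suc w ≡ n
  corank-nonsingular triv = ℕ.≤-antisym (rank≥1+w triv) (subst (_≤ m + suc w) (≡.sym (≡.trans n≡ (≡.sym (ℕ.+-suc s w))))
    (ℕ.+-monoˡ-≤ (suc w) s≤m))

  corank-singular : (z : Fin (suc w) → ℤ) → (∀ x → ∑ℤ.sum (λ y → z y ℤ.* bordered (adj H) x y) ≡ 0ℤ) →
    ∀ k → z (suc k) ≢ 0ℤ → m + w ≡ n
  corank-singular z z-null k zk≢0 = ℕ.≤-antisym rank≥w (subst (_≤ m + w) (≡.sym n≡) (ℕ.+-monoˡ-≤ w (1+s≤m z z-null k zk≢0)))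

  corank-cases : ∀ {r} → m + r ≡ n → (suc w ≡ r) ⊎ (w ≡ r)
  corank-cases {r} m+r≡n = [ (λ w<r → inj₁ (ℕ.≤-antisym w<r r≤1+w)) , inj₂ ]′ (ℕ.m≤n⇒m<n∨m≡n w≤r)
    where
    w≤r : w ≤ r
    w≤r = ℕ.+-cancelˡ-≤ m w r (ℕ.≤-trans rank≥w (ℕ.≤-reflexive (≡.sym m+r≡n)))
    r≤1+w : r ≤ suc w
    r≤1+w = ℕ.+-cancelˡ-≤ s r (suc w) (ℕ.≤-trans (ℕ.+-monoˡ-≤ r s≤m)
      (ℕ.≤-reflexive (≡.trans m+r≡n (≡.trans n≡ (≡.sym (ℕ.+-suc s w))))))

-- Enumeration of small graphs

Code : ℕ → Set
Code zero    = ⊤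
Code (suc w) = Vec Bool w × Code w

decode : ∀ {w} → Code w → Fin w → Fin w → Bool
decode (r , c) zero    zero    = false
decode (r , c) zero    (suc j) = lookup r j
decode (r , c) (suc i) zero    = lookup r i
decode (r , c) (suc i) (suc j) = decode c i j

encode : ∀ {w} → (Fin w → Fin w → Bool) → Code w
encode {zero}  h = tt
encode {suc w} h = Vec.tabulate (h zero ∘ suc) , encode (λ i j → h (suc i) (suc j))

-- Agreement is pointwise, so a test evaluated on all codes transfers to any graph without function
-- extensionality.
decode-encode : ∀ {w} (h : Fin w → Fin w → Bool) → (∀ i j → h i j ≡ h j i) → (∀ i → h i i ≡ false) →
  ∀ i j → h i j ≡ decode (encode h) i j
decode-encode {suc w} h h-sym h-irr zero    zero    = h-irr zero
decode-encode {suc w} h h-sym h-irr zero    (suc j) = ≡.sym (lookup∘tabulate (h zero ∘ suc) j)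
decode-encode {suc w} h h-sym h-irr (suc i) zero    = ≡.trans (h-sym (suc i) zero) (≡.sym (lookup∘tabulate (h zero ∘ suc) i))
decode-encode {suc w} h h-sym h-irr (suc i) (suc j) =
  decode-encode (λ i j → h (suc i) (suc j)) (λ i j → h-sym (suc i) (suc j)) (h-irr ∘ suc) i j

allVec : ∀ w → (Vec Bool w → Bool) → Bool
allVec zero    t = t []
allVec (suc w) t = allVec w (λ r → t (true ∷ r)) ∧ allVec w (λ r → t (false ∷ r))

allVec-sound : ∀ {w} t → allVec w t ≡ true → ∀ r → t r ≡ true
allVec-sound t e []          = e
allVec-sound {suc w} t e (true ∷ r)  = allVec-sound (λ r → t (true ∷ r)) (proj₁ (∧-true⁻ e)) r
allVec-sound {suc w} t e (false ∷ r) = allVec-sound (λ r → t (false ∷ r)) (proj₂ (∧-true⁻ {allVec w (λ r → t (true ∷ r))} e)) r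

allCode : ∀ w → (Code w → Bool) → Bool
allCode zero    t = t tt
allCode (suc w) t = allVec w (λ r → allCode w (λ c → t (r , c)))

allCode-sound : ∀ w t → allCode w t ≡ true → ∀ c → t c ≡ true
allCode-sound zero    t e tt      = e
allCode-sound (suc w) t e (r , c) = allCode-sound w (λ c → t (r , c)) (allVec-sound _ e r) c

universalAtᵇ : ∀ {w} → (Fin w → Fin w → Bool) → Fin w → Bool
universalAtᵇ h i = not (anyFin (λ j → not ⌊ i ≟ j ⌋ ∧ not (h i j)))

universalᵇ : ∀ {w} → (Fin w → Fin w → Bool) → Bool
universalᵇ h = anyFin (universalAtᵇ h)

nonsingularᵇ : ∀ {w} → (Fin w → Fin w → Bool) → Bool
nonsingularᵇ h = trivialKernelᵇ (rows (bordered h))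

permutations : ∀ w → List (Fin w ↔ Fin w)
permutations zero    = Permutation.id ∷ []
permutations (suc w) = List.concatMap (λ π → List.map (λ j → Permutation.insert zero j π) (List.allFin (suc w))) (permutations w)

isomorphismᵇ : ∀ {w} → (h h′ : Fin w → Fin w → Bool) → Fin w ↔ Fin w → Bool
isomorphismᵇ h h′ π = not (anyFin (λ i → anyFin (λ j → h i j xor h′ (Inverse.to π i) (Inverse.to π j))))

isoᵇ : ∀ {w} → (h h′ : Fin w → Fin w → Bool) → Bool
isoᵇ {w} h h′ = any (isomorphismᵇ h h′) (permutations w)

oneOfᵇ : ∀ {w} → List (Graph w) → (Fin w → Fin w → Bool) → Bool
oneOfᵇ Ts h = any (λ T → isoᵇ h (adj T)) Ts

not-true : ∀ {b} → not b ≡ true → b ≡ false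
not-true {false} _ = refl

not-false : ∀ {b} → not b ≡ false → b ≡ true
not-false {true} _ = refl

universalAtᵇ-true : ∀ {w} (h : Fin w → Fin w → Bool) {i} → universalAtᵇ h i ≡ true → ∀ j → i ≢ j → h i j ≡ true
universalAtᵇ-true h {i} e j i≢j with i ≟ j | h i j | anyFin-false⁻ (not-true e) j
... | yes i≡j | _    | _ = contradiction i≡j i≢j
... | no _    | true | _ = refl

universalAtᵇ-false : ∀ {w} (h : Fin w → Fin w → Bool) {i} → universalAtᵇ h i ≡ false → ∃ λ j → i ≢ j × h i j ≡ false
universalAtᵇ-false h {i} e with anyFin-true⁻ (not-false e)
... | j , eⱼ with i ≟ j | h i j in hij
... | no i≢j | false = j , i≢j , hij

universalᵇ-sound : ∀ {w} (h : Fin w → Fin w → Bool) → universalᵇ h ≡ true → ∃ λ i → ∀ j → i ≢ j → h i j ≡ true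
universalᵇ-sound h e with anyFin-true⁻ e
... | i , eᵢ = i , universalAtᵇ-true h eᵢ

universalᵇ-complete : ∀ {w} (H : Graph w) → universalᵇ (adj H) ≡ false → NoUniversal H
universalᵇ-complete H e i = universalAtᵇ-false (adj H) (anyFin-false⁻ e i)

bordered-cong : ∀ {w} {h h′ : Fin w → Fin w → Bool} → (∀ i j → h i j ≡ h′ i j) → ∀ x y → bordered h x y ≡ bordered h′ x y
bordered-cong h≗h′ zero    y       = refl
bordered-cong h≗h′ (suc i) zero    = refl
bordered-cong h≗h′ (suc i) (suc j) = cong (λ b → if ⌊ i ≟ j ⌋ then 1ℤ else (if b then 0ℤ else + 2)) (h≗h′ i j)

any-true⁻ : ∀ {A : Set} (t : A → Bool) xs → any t xs ≡ true → Any (λ x → t x ≡ true) xs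
any-true⁻ t (x ∷ xs) e with ∨-true⁻ {t x} e
... | inj₁ e₀ = here e₀
... | inj₂ e′ = there (any-true⁻ t xs e′)

xor-false : ∀ {a b} → a xor b ≡ false → a ≡ b
xor-false {true}  {true}  _ = refl
xor-false {false} {false} _ = refl

isoᵇ-sound : ∀ {w} (h h′ : Fin w → Fin w → Bool) → isoᵇ h h′ ≡ true →
  Σ[ π ∈ (Fin w ↔ Fin w) ] ∀ i j → h i j ≡ h′ (Inverse.to π i) (Inverse.to π j)
isoᵇ-sound h h′ e with Any.satisfied (any-true⁻ (isomorphismᵇ h h′) (permutations _) e)
... | π , eπ = π , λ i j → xor-false (anyFin-false⁻ (anyFin-false⁻ (not-true eπ) i) j)

module Classify {w} (H : Graph w) (noUniv : NoUniversal H) where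

  code : Fin w → Fin w → Bool
  code = decode (encode (adj H))

  adj≗code : ∀ i j → adj H i j ≡ code i j
  adj≗code = decode-encode (adj H) (Graph.sym H) (irrefl H)

  nonsingular : nonsingularᵇ code ≡ true → TrivialKernel (bordered (adj H))
  nonsingular e = TrivialKernel-cong (λ x y → ≡.sym (bordered-cong adj≗code x y)) (rows-sound (bordered code) e)

  iso : ∀ (T : Graph w) → isoᵇ code (adj T) ≡ true → H ≅ T
  iso T e with isoᵇ-sound code (adj T) e
  ... | π , π-adj = π , λ i j → ≡.trans (adj≗code i j) (π-adj i j)

  oneOf : ∀ Ts → oneOfᵇ Ts code ≡ true → Any (H ≅_) Ts
  oneOf Ts e = Any.map (λ {T} → iso T) (any-true⁻ (λ T → isoᵇ code (adj T)) Ts e)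

  -- Codes with a universal vertex pass the exhaustive check through the first disjunct; for `H`
  -- that disjunct contradicts `noUniv`.
  decided : ∀ (t : (Fin w → Fin w → Bool) → Bool) → allCode w (λ c → universalᵇ (decode c) ∨ t (decode c)) ≡ true → t code ≡ true
  decided t all with ∨-true⁻ {universalᵇ code} (allCode-sound w (λ c → universalᵇ (decode c) ∨ t (decode c)) all (encode (adj H)))
  ... | inj₂ e = e
  ... | inj₁ u with universalᵇ-sound code u
  ... | i , i-univ with noUniv i
  ... | j , i≢j , ¬a with () ← ≡.trans (≡.sym ¬a) (≡.trans (adj≗code i j) (i-univ j i≢j))

  classify-nonsingular : ∀ Ts → allCode w (λ c → universalᵇ (decode c) ∨ (nonsingularᵇ (decode c) ∧ oneOfᵇ Ts (decode c))) ≡ true →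
    TrivialKernel (bordered (adj H)) × Any (H ≅_) Ts
  classify-nonsingular Ts all with ∧-true⁻ (decided (λ h → nonsingularᵇ h ∧ oneOfᵇ Ts h) all)
  ... | e , e′ = nonsingular e , oneOf Ts e′

  classify-singular : ∀ Ts → allCode w (λ c → universalᵇ (decode c) ∨ (nonsingularᵇ (decode c) ∨ oneOfᵇ Ts (decode c))) ≡ true →
    TrivialKernel (bordered (adj H)) ⊎ Any (H ≅_) Ts
  classify-singular Ts all with ∨-true⁻ (decided (λ h → nonsingularᵇ h ∨ oneOfᵇ Ts h) all)
  ... | inj₁ e = inj₁ (nonsingular e)
  ... | inj₂ e = inj₂ (oneOf Ts e)

classify₂ : (H : Graph 2) → NoUniversal H → TrivialKernel (bordered (adj H)) × Any (H ≅_) (E 2 ∷ [])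
classify₂ H noUniv = Classify.classify-nonsingular H noUniv _ refl

classify₃ : (H : Graph 3) → NoUniversal H → TrivialKernel (bordered (adj H)) × Any (H ≅_) ((K 2 ∪ K 1) ∷ E 3 ∷ [])
classify₃ H noUniv = Classify.classify-nonsingular H noUniv _ refl

classify₄ : (H : Graph 4) → NoUniversal H → TrivialKernel (bordered (adj H)) ×
  Any (H ≅_) (E 4 ∷ (E 2 ∪ K 2) ∷ (P 3 ∪ K 1) ∷ (K 2 ∪ K 2) ∷ P 4 ∷ (K 3 ∪ K 1) ∷ C 4 ∷ [])
classify₄ H noUniv = Classify.classify-nonsingular H noUniv _ refl

-- Evaluated over all 2^10 labelled graphs. With B the complement of H, singularity of `bordered`
-- means 1ᵀ(I + 2B)⁻¹1 = 1; for C_5 this reads 5 · (1/5) = 1, as I + 2B has all row sums 5.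
classify₅ : (H : Graph 5) → NoUniversal H →
  TrivialKernel (bordered (adj H)) ⊎ Any (H ≅_) (C 5 ∷ (K 1 ∪ P 4) ∷ Bull ∷ [])
classify₅ H noUniv = Classify.classify-singular H noUniv _ refl

JoinForm-≅ : ∀ {n s w} {G : Graph n} {H T : Graph w} → JoinForm G s H → H ≅ T → JoinForm G s T
JoinForm-≅ {s = s} {H = H} {T} (β , β-adj) (π , π-adj) = ((↔-id (Fin s) ⊎-↔ π) ↔-∘ β) , λ u v u≢v →
  ≡.trans (β-adj u v u≢v) (join-≅ (Inverse.to β u) (Inverse.to β v))
  where
  join-≅ : ∀ x y → joinAdj H x y ≡ joinAdj T (Inverse.to (↔-id (Fin s) ⊎-↔ π) x) (Inverse.to (↔-id (Fin s) ⊎-↔ π) y)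
  join-≅ (inj₁ _) y        = refl
  join-≅ (inj₂ i) (inj₁ _) = refl
  join-≅ (inj₂ i) (inj₂ j) = π-adj i j

-- Graphs of radius at least two

induced : ∀ {n w} → Graph n → (Fin w → Fin n) → Graph w
induced G f = record
  { adj    = λ i j → adj G (f i) (f j)
  ; sym    = λ i j → Graph.sym G (f i) (f j)
  ; irrefl = λ i → irrefl G (f i) }

record Cone {n} (G : Graph n) : Set where
  constructor cone
  field
    {s w}  : ℕ
    H      : Graph w
    noUniv : NoUniversal H
    form   : JoinForm G (suc s) H

-- The clique takes all universal vertices at once. The remainder then has no universal vertex of
-- its own, because a non-neighbour of a vertex is itself non-universal and so stays in the
-- remainder.
cone-or-radius≥2 : ∀ {n} (G : Graph n) → Connected G → Cone G ⊎ (∀ u → 2 ≤ ecc G u)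
cone-or-radius≥2 {n} G conn with partition (universalAtᵇ (adj G))
... | zero , w , β , _ , nonuniv = inj₂ (λ u → far u (Inverse.to β u) refl)
  where
  open Distance G conn
  far : ∀ u x → Inverse.to β u ≡ x → 2 ≤ ecc G u
  far u (inj₂ j) u≡ with universalAtᵇ-false (adj G) (nonuniv j)
  ... | v , u≢v , ¬a = subst (λ u → 2 ≤ ecc G u) (≡.trans (cong (Inverse.from β) (≡.sym u≡)) (Inverse.strictlyInverseʳ β u))
          (ℕ.≤-trans (¬adj⇒2≤dist u≢v ¬a) (dist≤ecc′ _ v))
... | suc s , w , β , univ , nonuniv = inj₁ (cone H noUniv (β , β-adj))
  where
  open Inverse β using (to; from; strictlyInverseˡ; strictlyInverseʳ)
  H : Graph w
  H = induced G (λ j → from (inj₂ j))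
  from-to : ∀ {u x} → to u ≡ x → from x ≡ u
  from-to {u} refl = strictlyInverseʳ u
  universal : ∀ {u i} → to u ≡ inj₁ i → ∀ v → u ≢ v → adj G u v ≡ true
  universal {i = i} u≡ = subst (λ u → ∀ v → u ≢ v → adj G u v ≡ true) (from-to u≡) (universalAtᵇ-true (adj G) (univ i))
  noUniv : NoUniversal H
  noUniv i with universalAtᵇ-false (adj G) (nonuniv i)
  ... | v , u≢v , ¬a = by-class (to v) refl
    where
    by-class : ∀ x → to v ≡ x → ∃ λ j → i ≢ j × adj H i j ≡ false
    by-class (inj₁ k) v≡ with () ← ≡.trans (≡.sym ¬a) (≡.trans (Graph.sym G _ v) (universal v≡ _ (u≢v ∘ ≡.sym)))
    by-class (inj₂ j) v≡ = j , (λ i≡j → u≢v (≡.trans (cong (from ∘ inj₂) i≡j) (from-to v≡))) ,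
      ≡.trans (cong (adj G (from (inj₂ i))) (from-to v≡)) ¬a
  β-adj : ∀ u v → u ≢ v → adj G u v ≡ joinAdj H (to u) (to v)
  β-adj u v u≢v = by-class (to u) (to v) refl refl
    where
    by-class : ∀ x y → to u ≡ x → to v ≡ y → adj G u v ≡ joinAdj H x y
    by-class (inj₁ i) y        u≡ v≡ = universal u≡ v u≢v
    by-class (inj₂ i) (inj₁ j) u≡ v≡ = ≡.trans (Graph.sym G u v) (universal v≡ u (u≢v ∘ ≡.sym))
    by-class (inj₂ i) (inj₂ j) u≡ v≡ = ≡.sym (cong₂ (adj G) (from-to u≡) (from-to v≡))

NoUniversal-1 : ¬ Σ (Graph 1) NoUniversal
NoUniversal-1 (H , noUniv) with noUniv zero
... | zero , 0≢0 , _ = 0≢0 refl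

only-5 : ∀ {e} → 2 ≤ e → e ≤ 5 → ¬ (2 ∣ e) → ¬ (3 ∣ e) → e ≡ 5
only-5 {2} _ _ ¬2 ¬3 = contradiction (divides 1 refl) ¬2
only-5 {3} _ _ ¬2 ¬3 = contradiction (divides 1 refl) ¬3
only-5 {4} _ _ ¬2 ¬3 = contradiction (divides 2 refl) ¬2
only-5 {5} _ _ ¬2 ¬3 = refl
only-5 {suc zero} (s≤s ()) _ _ _
only-5 {suc (suc (suc (suc (suc (suc _)))))} _ (s≤s (s≤s (s≤s (s≤s (s≤s ()))))) _ _

module Radius≥2 {n} (G : Graph n) (conn : Connected G) {m} (mult : HasEigMult (eccMatrix G) (- 1ℚ) m)
  (2≤ecc : ∀ u → 2 ≤ ecc G u) where
  open Distance G conn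
  open Multiplicity G conn mult

  ecc≤ : ∀ {r} → m + r ≡ n → ∀ v → ecc G v ≤ r
  ecc≤ {r} m+r≡n v = ℕ.+-cancelˡ-≤ m _ r (ℕ.≤-trans (ecc≤rank 2≤ecc v) (ℕ.≤-reflexive (≡.sym m+r≡n)))

  -- What the sieve leaves has eccentricity exactly 5 and is a third divisor class, for k = 5; each
  -- of the three classes has at most five vertices.
  order≤15 : m + 5 ≡ n → n ≤ 15
  order≤15 m+5≡n = from-sieve (sieve m+5≡n)
    where
    from-sieve : (Σ[ w ∈ ℕ ] Σ[ f ∈ (Fin w → Fin n) ] Injective f × n ≤ 5 + 5 + w ×
      (∀ i → ¬ (2 ∣ ecc G (f i)) × ¬ (3 ∣ ecc G (f i)))) → n ≤ 15
    from-sieve (w , f , f-inj , n≤ , rest) = ℕ.≤-trans n≤ (ℕ.+-monoʳ-≤ 10 w≤5)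
      where
      w≤5 : w ≤ 5
      w≤5 = ℕ.+-cancelˡ-≤ m w 5 (ℕ.≤-trans (∣ecc⇒rank≥ 5 (s≤s (s≤s z≤n)) f f-inj (λ i → divides 1
        (≡.trans (only-5 (2≤ecc (f i)) (ecc≤ m+5≡n (f i)) (proj₁ (rest i)) (proj₂ (rest i))) refl)))
        (ℕ.≤-reflexive (≡.sym m+5≡n)))

  order≤8 : m + 4 ≡ n → n ≤ 8
  order≤8 m+4≡n = from-sieve (sieve m+4≡n)
    where
    from-sieve : (Σ[ w ∈ ℕ ] Σ[ f ∈ (Fin w → Fin n) ] Injective f × n ≤ 4 + 4 + w ×
      (∀ i → ¬ (2 ∣ ecc G (f i)) × ¬ (3 ∣ ecc G (f i)))) → n ≤ 8
    from-sieve (zero  , _ , _ , n≤ , _) = n≤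
    -- No number from 2 to 4 is prime to 6: a survivor would have eccentricity 5, above the bound 4.
    from-sieve (suc w , f , _ , _ , rest) = contradiction
      (subst (_≤ 4) (only-5 (2≤ecc (f zero)) (ℕ.m≤n⇒m≤1+n (ecc≤ m+4≡n (f zero))) (proj₁ (rest zero)) (proj₂ (rest zero)))
        (ecc≤ m+4≡n (f zero)))
      λ { (s≤s (s≤s (s≤s (s≤s ())))) }

  -- If all eccentricities are 2, the whole matrix A + I is I modulo 2, hence nonsingular.
  selfCentred⇒order≤ : ∀ {r} → m + r ≡ n → (∀ u → ecc G u ≡ 2) → n ≤ r
  selfCentred⇒order≤ {r} m+r≡n ecc≡2 = ℕ.+-cancelˡ-≤ m n r (ℕ.≤-trans
    (∣ecc⇒rank≥ 2 ℕ.≤-refl (λ u → u) (λ _ _ e → e) (λ u → divides 1 (≡.trans (ecc≡2 u) refl)))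
    (ℕ.≤-reflexive (≡.sym m+r≡n)))

  corank≢1 : Fin n → m + 1 ≢ n
  corank≢1 v m+1≡n = contradiction (ℕ.≤-trans (2≤ecc v) (ecc≤ m+1≡n v)) λ { (s≤s ()) }

  geodesic-order : ∀ v → 1 + ecc G v ≤ n
  geodesic-order v = Fin.injective⇒≤ {f = λ (i : Fin (1 + ecc G v)) → g (toℕ i)} (λ {i} {j} → g-injective i j)
    where
    u = proj₁ (ecc-attained v)
    g = proj₁ (geodesic v u)
    g-dist : ∀ i → i ≤ ecc G v → dist G v (g i) ≡ i
    g-dist i i≤ = ≡.trans (cong (λ x → dist G x (g i)) (≡.sym (proj₁ (proj₂ (geodesic v u)))))
      (proj₂ (proj₂ (proj₂ (geodesic v u))) 0 i (subst (i ≤_) (≡.sym (proj₂ (ecc-attained v))) i≤))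
    bound : ∀ (i : Fin (1 + ecc G v)) → toℕ i ≤ ecc G v
    bound i = ℕ.s≤s⁻¹ (Fin.toℕ<n i)
    g-injective : ∀ (i j : Fin (1 + ecc G v)) → g (toℕ i) ≡ g (toℕ j) → i ≡ j
    g-injective i j e = Fin.toℕ-injective (≡.trans (≡.sym (g-dist (toℕ i) (bound i)))
      (≡.trans (cong (dist G v) e) (g-dist (toℕ j) (bound j))))

  -- Eccentricities are squeezed to 2, which forces n ≤ 2, whereas a geodesic of length 2 has three
  -- vertices.
  corank≢2 : Fin n → m + 2 ≢ n
  corank≢2 v m+2≡n = contradiction (ℕ.≤-trans (s≤s (2≤ecc v)) (ℕ.≤-trans (geodesic-order v)
    (selfCentred⇒order≤ m+2≡n (λ u → ℕ.≤-antisym (ecc≤ m+2≡n u) (2≤ecc u))))) λ { (s≤s (s≤s ())) }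

-- The path on four vertices

≅-sym : ∀ {n n′} {G : Graph n} {H : Graph n′} → G ≅ H → H ≅ G
≅-sym {G = G} {H} (f , f-adj) = ↔-sym f , λ u v → ≡.sym (≡.trans (f-adj _ _)
  (cong₂ (adj H) (Inverse.strictlyInverseˡ f u) (Inverse.strictlyInverseˡ f v)))

within-≅ : ∀ {n n′} {G : Graph n} {H : Graph n′} (e : G ≅ H) k {u v} → within G k u v ≡ true →
  within H k (Inverse.to (proj₁ e) u) (Inverse.to (proj₁ e) v) ≡ true
within-≅ {G = G} {H} (f , f-adj) zero {u} w with refl ← Within.within-0⁻ G w = Within.within-refl H (Inverse.to f u)
within-≅ {G = G} {H} e@(f , f-adj) (suc k) {u} {v} w with Within.within-suc⁻ G {k} w
... | inj₁ w′ = ∨-trueˡ (within-≅ e k w′)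
... | inj₂ (x , w′ , a) = Within.within-adj H {k} (within-≅ e k w′) (≡.trans (≡.sym (f-adj x v)) a)

dist-≅-≤ : ∀ {n n′} (G : Graph n) (H : Graph n′) → Connected G → Connected H → (e : G ≅ H) → ∀ u v →
  dist H (Inverse.to (proj₁ e) u) (Inverse.to (proj₁ e) v) ≤ dist G u v
dist-≅-≤ G H connG connH e u v =
  Distance.within⇒dist≤ H connH (dist G u v) (within-≅ e (dist G u v) (Distance.within-dist G connG u v))

module Isomorphic {n n′} (G : Graph n) (H : Graph n′) (connG : Connected G) (connH : Connected H) (e : G ≅ H) where
  open Inverse (proj₁ e) using (to; from; strictlyInverseˡ; strictlyInverseʳ)

  dist-≅ : ∀ u v → dist G u v ≡ dist H (to u) (to v)
  dist-≅ u v = ℕ.≤-antisym (subst₂ (λ x y → dist G x y ≤ dist H (to u) (to v)) (strictlyInverseʳ u) (strictlyInverseʳ v)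
    (dist-≅-≤ H G connH connG (≅-sym {G = G} {H} e) (to u) (to v))) (dist-≅-≤ G H connG connH e u v)

  ecc-≅ : ∀ v → ecc G v ≡ ecc H (to v)
  ecc-≅ v = ℕ.≤-antisym
    (maxFin-least (λ u → dist G u v) (λ u → subst (_≤ ecc H (to v)) (≡.sym (dist-≅ u v)) (maxFin-upper (λ x → dist H x (to v)) (to u))))
    (maxFin-least (λ x → dist H x (to v)) (λ x → subst (_≤ ecc G v)
      (≡.trans (dist-≅ (from x) v) (cong (λ y → dist H y (to v)) (strictlyInverseˡ x))) (maxFin-upper (λ u → dist G u v) (from x))))

  M-≅ : ∀ u v → M G u v ≡ M H (to u) (to v)
  M-≅ u v = cong₂ (λ d x → d ℤ.+ + x) (≡.sym (δ-injective (λ _ _ → to-injective (proj₁ e)) u v))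
    (cong₂ (λ d m → if d ℕ.≡ᵇ m then d else 0) (dist-≅ u v) (cong₂ ℕ._⊓_ (ecc-≅ u) (ecc-≅ v)))

entryValue : ℕ → ℕ → ℕ → ℕ
entryValue d e e′ = if d ℕ.≡ᵇ (e ℕ.⊓ e′) then d else 0

matrix : ∀ {k} → Vec (Vec ℤ k) k → Fin k → Fin k → ℤ
matrix t i j = lookup (lookup t i) j

-- The block of A + I on a geodesic of length 3, where only the two entries at distance 2 are open.
-- Its determinant is x²y² - x² - y² - 8, which vanishes at x = y = 2.
pathMatrix : ℕ → ℕ → Fin 4 → Fin 4 → ℤ
pathMatrix x y = matrix
  ( (1ℤ ∷ 0ℤ ∷ + x ∷ + 3 ∷ [])
  ∷ (0ℤ ∷ 1ℤ ∷ 0ℤ ∷ + y ∷ [])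
  ∷ (+ x ∷ 0ℤ ∷ 1ℤ ∷ 0ℤ ∷ [])
  ∷ (+ 3 ∷ + y ∷ 0ℤ ∷ 1ℤ ∷ []) ∷ [])

-- The block on the first three vertices of such a geodesic and a further vertex. Its determinant is
-- 3y² - x² - z² + 4xz - 3; among the admissible values it vanishes only at (x, y, z) = (3, 2, 0).
cornerMatrix : ℕ → ℕ → ℕ → Fin 4 → Fin 4 → ℤ
cornerMatrix x y z = matrix
  ( (1ℤ ∷ 0ℤ ∷ + 2 ∷ + x ∷ [])
  ∷ (0ℤ ∷ 1ℤ ∷ 0ℤ ∷ + y ∷ [])
  ∷ (+ 2 ∷ 0ℤ ∷ 1ℤ ∷ + z ∷ [])
  ∷ (+ x ∷ + y ∷ + z ∷ 1ℤ ∷ []) ∷ [])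

pathMatrix-nonsingular : ∀ {a b} → (a ≡ 2) ⊎ (a ≡ 3) → (b ≡ 2) ⊎ (b ≡ 3) →
  TrivialKernel (pathMatrix (entryValue 2 3 b) (entryValue 2 a 3)) ⊎ ((a ≡ 2) × (b ≡ 2))
pathMatrix-nonsingular (inj₁ refl) (inj₁ refl) = inj₂ (refl , refl)
pathMatrix-nonsingular (inj₁ refl) (inj₂ refl) = inj₁ (rows-sound (pathMatrix 0 2) refl)
pathMatrix-nonsingular (inj₂ refl) (inj₁ refl) = inj₁ (rows-sound (pathMatrix 2 0) refl)
pathMatrix-nonsingular (inj₂ refl) (inj₂ refl) = inj₁ (rows-sound (pathMatrix 0 0) refl)

cornerMatrix-nonsingular : ∀ {a x y z} → (a ≡ 2) ⊎ (a ≡ 3) → (x ≡ 0) ⊎ (x ≡ a ℕ.⊓ 3) → (y ≡ 0) ⊎ (y ≡ a ℕ.⊓ 2) →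
  (z ≡ 0) ⊎ (z ≡ a ℕ.⊓ 2) → TrivialKernel (cornerMatrix x y z) ⊎ ((y ≡ 2) × (z ≡ 0))
cornerMatrix-nonsingular (inj₁ refl) (inj₁ refl) (inj₁ refl) (inj₁ refl) = inj₁ (rows-sound (cornerMatrix 0 0 0) refl)
cornerMatrix-nonsingular (inj₁ refl) (inj₁ refl) (inj₁ refl) (inj₂ refl) = inj₁ (rows-sound (cornerMatrix 0 0 2) refl)
cornerMatrix-nonsingular (inj₁ refl) (inj₁ refl) (inj₂ refl) (inj₁ refl) = inj₁ (rows-sound (cornerMatrix 0 2 0) refl)
cornerMatrix-nonsingular (inj₁ refl) (inj₁ refl) (inj₂ refl) (inj₂ refl) = inj₁ (rows-sound (cornerMatrix 0 2 2) refl)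
cornerMatrix-nonsingular (inj₁ refl) (inj₂ refl) (inj₁ refl) (inj₁ refl) = inj₁ (rows-sound (cornerMatrix 2 0 0) refl)
cornerMatrix-nonsingular (inj₁ refl) (inj₂ refl) (inj₁ refl) (inj₂ refl) = inj₁ (rows-sound (cornerMatrix 2 0 2) refl)
cornerMatrix-nonsingular (inj₁ refl) (inj₂ refl) (inj₂ refl) (inj₁ refl) = inj₁ (rows-sound (cornerMatrix 2 2 0) refl)
cornerMatrix-nonsingular (inj₁ refl) (inj₂ refl) (inj₂ refl) (inj₂ refl) = inj₁ (rows-sound (cornerMatrix 2 2 2) refl)
cornerMatrix-nonsingular (inj₂ refl) (inj₁ refl) (inj₁ refl) (inj₁ refl) = inj₁ (rows-sound (cornerMatrix 0 0 0) refl)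
cornerMatrix-nonsingular (inj₂ refl) (inj₁ refl) (inj₁ refl) (inj₂ refl) = inj₁ (rows-sound (cornerMatrix 0 0 2) refl)
cornerMatrix-nonsingular (inj₂ refl) (inj₁ refl) (inj₂ refl) (inj₁ refl) = inj₁ (rows-sound (cornerMatrix 0 2 0) refl)
cornerMatrix-nonsingular (inj₂ refl) (inj₁ refl) (inj₂ refl) (inj₂ refl) = inj₁ (rows-sound (cornerMatrix 0 2 2) refl)
cornerMatrix-nonsingular (inj₂ refl) (inj₂ refl) (inj₁ refl) (inj₁ refl) = inj₁ (rows-sound (cornerMatrix 3 0 0) refl)
cornerMatrix-nonsingular (inj₂ refl) (inj₂ refl) (inj₁ refl) (inj₂ refl) = inj₁ (rows-sound (cornerMatrix 3 0 2) refl)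
cornerMatrix-nonsingular (inj₂ refl) (inj₂ refl) (inj₂ refl) (inj₁ refl) = inj₂ (refl , refl)
cornerMatrix-nonsingular (inj₂ refl) (inj₂ refl) (inj₂ refl) (inj₂ refl) = inj₁ (rows-sound (cornerMatrix 3 2 2) refl)

P4-adj : ∀ i j → adj (P 4) i j ≡ (ℕ.∣ toℕ i - toℕ j ∣ ℕ.≡ᵇ 1)
P4-adj i j = xor-false (anyFin-false⁻ {f = λ j → adj (P 4) i j xor (ℕ.∣ toℕ i - toℕ j ∣ ℕ.≡ᵇ 1)}
  (anyFin-false⁻ {f = λ i → anyFin (λ j → adj (P 4) i j xor (ℕ.∣ toℕ i - toℕ j ∣ ℕ.≡ᵇ 1))} refl i) j)

2⊎3 : ∀ {a} → 2 ≤ a → a ≤ 3 → (a ≡ 2) ⊎ (a ≡ 3)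
2⊎3 {2} _ _ = inj₁ refl
2⊎3 {3} _ _ = inj₂ refl
2⊎3 {1} (s≤s ()) _
2⊎3 {suc (suc (suc (suc _)))} _ (s≤s (s≤s (s≤s ())))

quad : ∀ {A : Set} → A → A → A → A → Fin 4 → A
quad a b c d i = lookup (a ∷ b ∷ c ∷ d ∷ []) i

module Corank3 {n} (G : Graph n) (conn : Connected G) {m} (mult : HasEigMult (eccMatrix G) (- 1ℚ) m)
  (2≤ecc : ∀ u → 2 ≤ ecc G u) (m+3≡n : m + 3 ≡ n) where
  open Distance G conn
  open Multiplicity G conn mult
  open Radius≥2 G conn mult 2≤ecc

  eccValues : ∀ v → (ecc G v ≡ 2) ⊎ (ecc G v ≡ 3)
  eccValues v = 2⊎3 (2≤ecc v) (ecc≤ m+3≡n v)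

  singular : (f : Fin 4 → Fin n) {N : Fin 4 → Fin 4 → ℤ} → (∀ i j → N i j ≡ M G (f i) (f j)) → ¬ TrivialKernel N
  singular f N≡ triv = contradiction (ℕ.+-cancelˡ-≤ m 4 3 (ℕ.≤-trans (rank≥ f (TrivialKernel-cong N≡ triv))
    (ℕ.≤-reflexive (≡.sym m+3≡n)))) λ { (s≤s (s≤s (s≤s ()))) }

  diagonal : ∀ u → 1ℤ ≡ M G u u
  diagonal u = ≡.sym (cong₂ (λ d e → d ℤ.+ + e) (δ-refl u) (eccEntry-refl u))

  off : ∀ {u v e} → u ≢ v → eccEntry G u v ≡ e → + e ≡ M G u v
  off {u} {v} u≢v e≡ = ≡.sym (≡.trans (cong₂ (λ d e → d ℤ.+ + e) (δ-≢ u≢v) e≡) (ℤ.+-identityˡ _))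

  off′ : ∀ {u v e} → u ≢ v → eccEntry G u v ≡ e → + e ≡ M G v u
  off′ {u} {v} u≢v e≡ = off (u≢v ∘ ≡.sym) (≡.trans (eccEntry-sym v u) e≡)

  entry : ∀ {u v d e e′} → dist G u v ≡ d → ecc G u ≡ e → ecc G v ≡ e′ → eccEntry G u v ≡ entryValue d e e′
  entry d≡ e≡ e′≡ = cong₂ (λ d m → if d ℕ.≡ᵇ m then d else 0) d≡ (cong₂ ℕ._⊓_ e≡ e′≡)

  entryValues : ∀ {u v e} → ecc G v ≡ e → (eccEntry G u v ≡ 0) ⊎ (eccEntry G u v ≡ ecc G u ℕ.⊓ e)
  entryValues {u} {v} e≡ = [ inj₁ , (λ (x , y) → inj₂ (≡.trans x (≡.trans y (cong (ecc G u ℕ.⊓_) e≡)))) ]′ (eccEntry-values u v)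

  dist⇒≢ : ∀ {u v d} → dist G u v ≡ suc d → u ≢ v
  dist⇒≢ {u} d≡ u≡v = contradiction (≡.trans (≡.sym (dist-refl u)) (≡.trans (cong (dist G u) u≡v) d≡)) λ ()

  -- The triple is read inwards from an end of the geodesic. The outcome distinguishes q from r, and
  -- reversing the geodesic turns the middle vertices q and r into each other.
  corner : ∀ {p q r u} → dist G p q ≡ 1 → dist G q r ≡ 1 → dist G p r ≡ 2 → ecc G p ≡ 3 → ecc G q ≡ 2 → ecc G r ≡ 2 →
    u ≢ p → u ≢ q → u ≢ r → (eccEntry G u q ≡ 2) × (eccEntry G u r ≡ 0)
  corner {p} {q} {r} {u} pq qr pr ep eq er u≢p u≢q u≢r = [ (λ triv → contradiction triv (singular (quad p q r u) entries)) , (λ yz → yz) ]′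
    (cornerMatrix-nonsingular (eccValues u) (entryValues ep) (entryValues eq) (entryValues er))
    where
    entries : ∀ i j → cornerMatrix (eccEntry G u p) (eccEntry G u q) (eccEntry G u r) i j ≡ M G (quad p q r u i) (quad p q r u j)
    entries zero zero = diagonal p
    entries zero (suc zero) = off (dist⇒≢ pq) (entry pq ep eq)
    entries zero (suc (suc zero)) = off (dist⇒≢ pr) (entry pr ep er)
    entries zero (suc (suc (suc zero))) = off′ u≢p refl
    entries (suc zero) zero = off′ (dist⇒≢ pq) (entry pq ep eq)
    entries (suc zero) (suc zero) = diagonal q
    entries (suc zero) (suc (suc zero)) = off (dist⇒≢ qr) (entry qr eq er)
    entries (suc zero) (suc (suc (suc zero))) = off′ u≢q refl
    entries (suc (suc zero)) zero = off′ (dist⇒≢ pr) (entry pr ep er)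
    entries (suc (suc zero)) (suc zero) = off′ (dist⇒≢ qr) (entry qr eq er)
    entries (suc (suc zero)) (suc (suc zero)) = diagonal r
    entries (suc (suc zero)) (suc (suc (suc zero))) = off′ u≢r refl
    entries (suc (suc (suc zero))) zero = off u≢p refl
    entries (suc (suc (suc zero))) (suc zero) = off u≢q refl
    entries (suc (suc (suc zero))) (suc (suc zero)) = off u≢r refl
    entries (suc (suc (suc zero))) (suc (suc (suc zero))) = diagonal u

  module Path (g : ℕ → Fin n) (geo : ∀ i k → i + k ≤ 3 → dist G (g i) (g (i + k)) ≡ k) where

    ecc-end : ∀ {u v} → dist G u v ≡ 3 → ecc G u ≡ 3
    ecc-end {u} {v} d≡3 = ℕ.≤-antisym (ecc≤ m+3≡n u) (subst (_≤ ecc G u) d≡3 (dist≤ecc′ u v))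

    d01 : dist G (g 0) (g 1) ≡ 1
    d01 = geo 0 1 (s≤s z≤n)
    d12 : dist G (g 1) (g 2) ≡ 1
    d12 = geo 1 1 (s≤s (s≤s z≤n))
    d23 : dist G (g 2) (g 3) ≡ 1
    d23 = geo 2 1 ℕ.≤-refl
    d02 : dist G (g 0) (g 2) ≡ 2
    d02 = geo 0 2 (s≤s (s≤s z≤n))
    d13 : dist G (g 1) (g 3) ≡ 2
    d13 = geo 1 2 ℕ.≤-refl
    d03 : dist G (g 0) (g 3) ≡ 3
    d03 = geo 0 3 ℕ.≤-refl
    e0 : ecc G (g 0) ≡ 3
    e0 = ecc-end d03
    e3 : ecc G (g 3) ≡ 3
    e3 = ecc-end (≡.trans (dist-sym (g 3) (g 0)) d03)

    adjacent-entry : ∀ {u v} → dist G u v ≡ 1 → eccEntry G u v ≡ 0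
    adjacent-entry {u} {v} d≡1 = eccEntry-near (subst (_< ecc G u) (≡.sym d≡1) (2≤ecc u)) (subst (_< ecc G v) (≡.sym d≡1) (2≤ecc v))

    -- Corank 3 makes this 4 × 4 minor vanish, which fixes the two inner eccentricities and supplies
    -- the hypotheses of `corner`.
    inner : (ecc G (g 1) ≡ 2) × (ecc G (g 2) ≡ 2)
    inner = [ (λ triv → contradiction triv (singular p entries)) , (λ e → e) ]′
      (pathMatrix-nonsingular (eccValues (g 1)) (eccValues (g 2)))
      where
      p : Fin 4 → Fin n
      p = quad (g 0) (g 1) (g 2) (g 3)
      x : eccEntry G (g 0) (g 2) ≡ entryValue 2 3 (ecc G (g 2))
      x = entry d02 e0 refl
      y : eccEntry G (g 1) (g 3) ≡ entryValue 2 (ecc G (g 1)) 3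
      y = entry d13 refl e3
      entries : ∀ i j → pathMatrix (entryValue 2 3 (ecc G (g 2))) (entryValue 2 (ecc G (g 1)) 3) i j ≡ M G (p i) (p j)
      entries zero zero = diagonal (g 0)
      entries zero (suc zero) = off (dist⇒≢ d01) (adjacent-entry d01)
      entries zero (suc (suc zero)) = off (dist⇒≢ d02) x
      entries zero (suc (suc (suc zero))) = off (dist⇒≢ d03) (entry d03 e0 e3)
      entries (suc zero) zero = off′ (dist⇒≢ d01) (adjacent-entry d01)
      entries (suc zero) (suc zero) = diagonal (g 1)
      entries (suc zero) (suc (suc zero)) = off (dist⇒≢ d12) (adjacent-entry d12)
      entries (suc zero) (suc (suc (suc zero))) = off (dist⇒≢ d13) y
      entries (suc (suc zero)) zero = off′ (dist⇒≢ d02) x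
      entries (suc (suc zero)) (suc zero) = off′ (dist⇒≢ d12) (adjacent-entry d12)
      entries (suc (suc zero)) (suc (suc zero)) = diagonal (g 2)
      entries (suc (suc zero)) (suc (suc (suc zero))) = off (dist⇒≢ d23) (adjacent-entry d23)
      entries (suc (suc (suc zero))) zero = off′ (dist⇒≢ d03) (entry d03 e0 e3)
      entries (suc (suc (suc zero))) (suc zero) = off′ (dist⇒≢ d13) y
      entries (suc (suc (suc zero))) (suc (suc zero)) = off′ (dist⇒≢ d23) (adjacent-entry d23)
      entries (suc (suc (suc zero))) (suc (suc (suc zero))) = diagonal (g 3)

    e1 : ecc G (g 1) ≡ 2
    e1 = proj₁ inner
    e2 : ecc G (g 2) ≡ 2
    e2 = proj₂ inner

    -- The two corner minors force contradictory values of the entry between u and g 1.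
    spanning : ∀ u → ∃ λ (i : Fin 4) → g (toℕ i) ≡ u
    spanning u = by-dec (Fin.any? (λ (i : Fin 4) → g (toℕ i) ≟ u))
      where
      by-dec : Dec (∃ λ (i : Fin 4) → g (toℕ i) ≡ u) → ∃ λ (i : Fin 4) → g (toℕ i) ≡ u
      by-dec (yes found) = found
      by-dec (no outside) = contradiction
        (≡.trans (≡.sym (proj₁ (corner d01 d12 d02 e0 e1 e2 (≢g zero) (≢g (suc zero)) (≢g (suc (suc zero))))))
          (proj₂ (corner (≡.trans (dist-sym (g 3) (g 2)) d23) (≡.trans (dist-sym (g 2) (g 1)) d12)
            (≡.trans (dist-sym (g 3) (g 1)) d13) e3 e2 e1 (≢g (suc (suc (suc zero)))) (≢g (suc (suc zero))) (≢g (suc zero))))) λ ()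
        where
        ≢g : ∀ (i : Fin 4) → u ≢ g (toℕ i)
        ≢g i u≡ = outside (i , ≡.sym u≡)

    g-dist : ∀ (i j : Fin 4) → dist G (g (toℕ i)) (g (toℕ j)) ≡ ℕ.∣ toℕ i - toℕ j ∣
    g-dist i j = [ ordered i j , (λ j≤i → ≡.trans (dist-sym (g (toℕ i)) (g (toℕ j)))
        (≡.trans (ordered j i j≤i) (ℕ.∣-∣-comm (toℕ j) (toℕ i)))) ]′ (ℕ.≤-total (toℕ i) (toℕ j))
      where
      ordered : ∀ (i j : Fin 4) → toℕ i ≤ toℕ j → dist G (g (toℕ i)) (g (toℕ j)) ≡ ℕ.∣ toℕ i - toℕ j ∣
      ordered i j i≤j = ≡.trans (cong (λ k → dist G (g (toℕ i)) (g k)) (≡.sym (ℕ.m+[n∸m]≡n i≤j)))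
        (≡.trans (geo (toℕ i) (toℕ j ∸ toℕ i) (≡.subst (_≤ 3) (≡.sym (ℕ.m+[n∸m]≡n i≤j)) (ℕ.s≤s⁻¹ (Fin.toℕ<n j))))
          (≡.sym (ℕ.m≤n⇒∣m-n∣≡n∸m i≤j)))

    ≅P4 : G ≅ P 4
    ≅P4 = mk↔ₛ′ index (λ i → g (toℕ i)) index-g (λ u → proj₂ (spanning u)) , λ u v →
      ≡.trans (cong₂ (adj G) (≡.sym (proj₂ (spanning u))) (≡.sym (proj₂ (spanning v)))) (path-adj (index u) (index v))
      where
      index : Fin n → Fin 4
      index u = proj₁ (spanning u)
      index-g : ∀ i → index (g (toℕ i)) ≡ i
      index-g i = Fin.toℕ-injective (ℕ.∣m-n∣≡0⇒m≡n (≡.trans (≡.sym (g-dist (index (g (toℕ i))) i))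
        (≡.trans (cong (λ x → dist G x (g (toℕ i))) (proj₂ (spanning (g (toℕ i))))) (dist-refl (g (toℕ i))))))
      path-adj : ∀ (i j : Fin 4) → adj G (g (toℕ i)) (g (toℕ j)) ≡ adj (P 4) i j
      path-adj i j = ≡.trans (bool-ext
        (λ a → cong (ℕ._≡ᵇ 1) (≡.trans (≡.sym (g-dist i j)) (adj⇒dist≡1 a)))
        (λ e → dist≡1⇒adj (≡.trans (g-dist i j) (ℕ.≡ᵇ⇒≡ ℕ.∣ toℕ i - toℕ j ∣ 1 (≡true⇒T e))))) (≡.sym (P4-adj i j))

  path : 4 ≤ n → G ≅ P 4
  path 4≤n = by-dec (Fin.any? (λ v → ecc G v ℕ.≟ 3))
    where
    by-dec : Dec (∃ λ v → ecc G v ≡ 3) → G ≅ P 4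
    -- Without eccentricity 3 every eccentricity is 2, so the order is at most 3.
    by-dec (no none) = contradiction (ℕ.≤-trans 4≤n (selfCentred⇒order≤ m+3≡n (λ u → [ (λ e → e) ,
      (λ e → contradiction (u , e) none) ]′ (eccValues u)))) λ { (s≤s (s≤s (s≤s ()))) }
    by-dec (yes (v , e)) = Path.≅P4 (proj₁ geodesic-v) (λ i k le →
      proj₂ (proj₂ (proj₂ geodesic-v)) i k (subst (i + k ≤_) (≡.sym (≡.trans (proj₂ (ecc-attained v)) e)) le))
      where
      geodesic-v = geodesic v (proj₁ (ecc-attained v))

P4-connected : Connected (P 4)
P4-connected u v = bool-ext (λ _ → refl) (λ _ → not-false (anyFin-false⁻ {f = λ v → not (within (P 4) 4 u v)}
  (anyFin-false⁻ {f = λ u → anyFin (λ v → not (within (P 4) 4 u v))} refl u) v))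

P4-corank : ∀ {n} (G : Graph n) (conn : Connected G) {m} → HasEigMult (eccMatrix G) (- 1ℚ) m → G ≅ P 4 → m + 3 ≡ n
P4-corank {n} G conn {m} mult e = ℕ.≤-antisym rank≥3 (subst (_≤ m + 3) (≡.sym (Permutation.↔⇒≡ (proj₁ e))) (ℕ.+-monoˡ-≤ 3 1≤m))
  where
  open Isomorphic G (P 4) conn P4-connected e
  open Multiplicity G conn mult
  open Inverse (proj₁ e) using (to; from; strictlyInverseˡ)
  M-from : ∀ u j → M G u (from j) ≡ M (P 4) (to u) j
  M-from u j = ≡.trans (M-≅ u (from j)) (cong (M (P 4) (to u)) (strictlyInverseˡ j))
  z : Fin 4 → ℤ
  -- The kernel of `pathMatrix 2 2`, symmetric under reversal of the path.
  z = quad 1ℤ (ℤ.- + 2) (ℤ.- + 2) 1ℤ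
  z-null : ∀ i → ∑ℤ.sum (λ j → z j ℤ.* M (P 4) i j) ≡ 0ℤ
  z-null zero = refl
  z-null (suc zero) = refl
  z-null (suc (suc zero)) = refl
  z-null (suc (suc (suc zero))) = refl
  rank≥3 : m + 3 ≤ n
  -- The first three path vertices give a block of determinant -3.
  rank≥3 = rank≥ (λ i → from (Fin.inject₁ i)) (TrivialKernel-cong (λ i j → ≡.sym (≡.trans (M-from _ (Fin.inject₁ j))
    (cong (λ x → M (P 4) x (Fin.inject₁ j)) (strictlyInverseˡ (Fin.inject₁ i)))))
    (rows-sound (λ (i j : Fin 3) → M (P 4) (Fin.inject₁ i) (Fin.inject₁ j)) refl))
  1≤m : 1 ≤ m
  1≤m = nullity≥ (λ (_ : Fin 1) → comb (unitVectors from) (ι ∘ z))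
    (λ _ → Null-unit {N = M G} from z (λ u → ≡.trans (∑ℤ.sum-cong-≗ (λ j → cong (z j ℤ.*_) (M-from u j))) (z-null (to u))))
    (λ _ → from zero)
    (λ _ e → 1≢0 (≡.trans (≡.sym value) e))
    (λ { zero zero 0≢0 → contradiction refl 0≢0 })
    where
    1≢0 : ι 1ℤ ≢ 0ℚ
    1≢0 ()
    value : comb (unitVectors from) (ι ∘ z) (from zero) ≡ ι 1ℤ
    value = ≡.trans (unit-value from z (from zero)) (cong ι (≡.trans (∑ℤ.sum-cong-≗ (λ j →
      cong (z j ℤ.*_) (δ-injective (λ _ _ → from-injective (proj₁ e)) j zero))) refl))

-- Complete graphs and the assembly by corank

complete : ∀ {n s} {G : Graph n} {H : Graph 0} → JoinForm G s H → G ≅ K n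
complete {n} {s} {G} {H} (β , β-adj) = ↔-id (Fin n) , λ u v → by-dec u v (u ≟ v)
  where
  all-adjacent : ∀ x y → joinAdj {s} H x y ≡ true
  all-adjacent (inj₁ _) _ = refl
  by-dec : ∀ u v → Dec (u ≡ v) → adj G u v ≡ adj (K n) u v
  by-dec u v (yes refl) = ≡.trans (irrefl G u) (≡.sym (irrefl (K n) u))
  by-dec u v (no u≢v)   = ≡.trans (β-adj u v u≢v) (≡.trans (all-adjacent (Inverse.to β u) (Inverse.to β v)) (≡.sym (K-adj u≢v)))

-- Reading K_n as a join with the empty graph lets the general corank formula for cones apply, with
-- `bordered` reduced to the 1 × 1 matrix 1.
complete⁻ : ∀ {n} {G : Graph n} → G ≅ K n → JoinForm G n (E 0)
complete⁻ {n} {G} (f , f-adj) = mk↔ₛ′ (inj₁ ∘ Inverse.to f) back to∘from (Inverse.strictlyInverseʳ f) , λ u v u≢v →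
  ≡.trans (f-adj u v) (K-adj (u≢v ∘ to-injective f))
  where
  back : Fin n ⊎ Fin 0 → Fin n
  back (inj₁ i) = Inverse.from f i
  to∘from : ∀ x → inj₁ (Inverse.to f (back x)) ≡ x
  to∘from (inj₁ i) = cong inj₁ (Inverse.strictlyInverseˡ f i)

nullVector : ∀ {k} (N : Fin k → Fin k → ℤ) (z : Fin k → ℤ) →
  anyFin (λ x → not ⌊ ∑ℤ.sum (λ y → z y ℤ.* N x y) ℤ.≟ 0ℤ ⌋) ≡ false → ∀ x → ∑ℤ.sum (λ y → z y ℤ.* N x y) ≡ 0ℤ
nullVector N z e x with ∑ℤ.sum (λ y → z y ℤ.* N x y) ℤ.≟ 0ℤ | anyFin-false⁻ e x
... | yes z≡0 | _ = z≡0

module Theorem {n} (1≤n : 1 ≤ n) (G : Graph n) (conn : Connected G) {m} (mult : HasEigMult (eccMatrix G) (- 1ℚ) m) where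

  by-radius : ∀ {A : Set} r → m + r ≡ n →
    (∀ {s w} (H : Graph w) → NoUniversal H → JoinForm G (suc s) H → suc w ≡ r → A) →
    (∀ {s} (H : Graph r) → NoUniversal H → JoinForm G (suc s) H → A) →
    ((∀ u → 2 ≤ ecc G u) → A) → A
  by-radius r m+r≡n nonsingular singular radius≥2 = [ of-cone , radius≥2 ]′ (cone-or-radius≥2 G conn)
    where
    of-cone : Cone G → _
    of-cone (cone {s} H noUniv form) = [ nonsingular H noUniv form , (λ { refl → singular {s} H noUniv form }) ]′
      (JoinRank.corank-cases G conn mult H noUniv form m+r≡n)

  vertex : Fin n
  vertex = Fin.fromℕ< 1≤n

  -- Rules out r = |H| for nonsingular `bordered`, where the corank is |H| + 1.
  wrong-corank : ∀ {A : Set} {r s w} → m + r ≡ n → (H : Graph w) → NoUniversal H → JoinForm G (suc s) H →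
    r ≢ suc w → TrivialKernel (bordered (adj H)) → A
  wrong-corank {r = r} m+r≡n H noUniv form r≢ triv = contradiction
    (ℕ.+-cancelˡ-≡ m r _ (≡.trans m+r≡n (≡.sym (JoinRank.corank-nonsingular G conn mult H noUniv form triv)))) r≢

  joined : ∀ {s w} (H T : Graph w) → JoinForm G (suc s) H → H ≅ T → G ≅ (K (n ∸ w) ∨G T)
  joined {s} {w} H T form e = subst (λ k → G ≅ (K k ∨G T))
    (≡.sym (≡.trans (cong (_∸ w) (Bijection⊎ (proj₁ form))) (ℕ.m+n∸n≡m (suc s) w)))
    (JoinForm⇒≅ {G = G} {T} (JoinForm-≅ {G = G} {H} {T} form e))

  corank-join : ∀ {k w} (T : Graph w) → 1 ≤ k → universalᵇ (adj T) ≡ false → trivialKernelᵇ (rows (bordered (adj T))) ≡ true →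
    JoinForm G k T → m + suc w ≡ n
  corank-join {suc s} T _ nu triv = λ form → JoinRank.corank-nonsingular G conn mult T (universalᵇ-complete T nu) form
    (rows-sound (bordered (adj T)) triv)

  corank-≅ : ∀ {w} (T : Graph w) → w < n → universalᵇ (adj T) ≡ false → trivialKernelᵇ (rows (bordered (adj T))) ≡ true →
    G ≅ (K (n ∸ w) ∨G T) → m + suc w ≡ n
  corank-≅ T w<n nu triv e = corank-join T (ℕ.m<n⇒0<n∸m w<n) nu triv (≅⇒JoinForm {G = G} {T} e)

  corank-≅-singular : ∀ {k w} (T : Graph w) → 1 ≤ k → universalᵇ (adj T) ≡ false → (z : Fin (suc w) → ℤ) →
    anyFin (λ x → not ⌊ ∑ℤ.sum (λ y → z y ℤ.* bordered (adj T) x y) ℤ.≟ 0ℤ ⌋) ≡ false → (∃ λ i → z (suc i) ≢ 0ℤ) →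
    G ≅ (K k ∨G T) → m + w ≡ n
  corank-≅-singular {suc s} T _ nu z z-null (i , zᵢ≢0) e = JoinRank.corank-singular G conn mult T (universalᵇ-complete T nu)
    (≅⇒JoinForm {G = G} {T} e) z (nullVector (bordered (adj T)) z z-null) i zᵢ≢0

  corank1 : (m + 1 ≡ n) ⇔ (G ≅ K n)
  corank1 = mk⇔
    (λ m+1≡n → by-radius 1 m+1≡n
      (λ { H _ form refl → complete {G = G} {H} form })
      (λ H noUniv _ → contradiction (H , noUniv) NoUniversal-1)
      (λ 2≤ecc → contradiction m+1≡n (Radius≥2.corank≢1 G conn mult 2≤ecc vertex)))
    (λ e → corank-join (E 0) 1≤n refl refl (complete⁻ {G = G} e))

  -- With a universal vertex, |H| = 1 is impossible because a single vertex is universal, and |H| =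
  -- 2 leaves only 2K_1, whose corank is 3.
  corank2 : m + 2 ≢ n
  corank2 m+2≡n = by-radius 2 m+2≡n
    (λ { H noUniv _ refl → contradiction (H , noUniv) NoUniversal-1 })
    (λ H noUniv form → wrong-corank m+2≡n H noUniv form (λ ()) (proj₁ (classify₂ H noUniv)))
    (λ 2≤ecc → contradiction m+2≡n (Radius≥2.corank≢2 G conn mult 2≤ecc vertex))

  corank3 : 4 ≤ n → (m + 3 ≡ n) ⇔ ((G ≅ (K (n ∸ 2) ∨G E 2)) ⊎ (G ≅ P 4))
  corank3 4≤n = mk⇔
    (λ m+3≡n → by-radius 3 m+3≡n
      (λ { H noUniv form refl → inj₁ (only H (joined H (E 2) form) (proj₂ (classify₂ H noUniv))) })
      (λ H noUniv form → wrong-corank m+3≡n H noUniv form (λ ()) (proj₁ (classify₃ H noUniv)))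
      (λ 2≤ecc → inj₂ (Corank3.path G conn mult 2≤ecc m+3≡n 4≤n)))
    [ corank-≅ (E 2) (ℕ.≤-trans (ℕ.m≤m+n 3 1) 4≤n) refl refl , P4-corank G conn mult ]′
    where
    only : ∀ (H : Graph 2) {A : Set} → (H ≅ E 2 → A) → Any (H ≅_) (E 2 ∷ []) → A
    only H f (here e) = f e

  corank4 : 9 ≤ n → (m + 4 ≡ n) ⇔ ((G ≅ (K (n ∸ 3) ∨G (K 2 ∪ K 1))) ⊎ (G ≅ (K (n ∸ 3) ∨G E 3)))
  corank4 9≤n = mk⇔
    (λ m+4≡n → by-radius 4 m+4≡n
      (λ { H noUniv form refl → which H form (proj₂ (classify₃ H noUniv)) })
      (λ H noUniv form → wrong-corank m+4≡n H noUniv form (λ ()) (proj₁ (classify₄ H noUniv)))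
      (λ 2≤ecc → contradiction (ℕ.≤-trans 9≤n (Radius≥2.order≤8 G conn mult 2≤ecc m+4≡n)) (ℕ.<-irrefl refl)))
    [ corank-≅ (K 2 ∪ K 1) 3<n refl refl , corank-≅ (E 3) 3<n refl refl ]′
    where
    3<n : 3 < n
    3<n = ℕ.≤-trans (ℕ.m≤m+n 4 5) 9≤n
    which : ∀ {s} (H : Graph 3) → JoinForm G (suc s) H → Any (H ≅_) ((K 2 ∪ K 1) ∷ E 3 ∷ []) →
      (G ≅ (K (n ∸ 3) ∨G (K 2 ∪ K 1))) ⊎ (G ≅ (K (n ∸ 3) ∨G E 3))
    which H form (here e)         = inj₁ (joined H (K 2 ∪ K 1) form e)
    which H form (there (here e)) = inj₂ (joined H (E 3) form e)

  corank5 : 16 ≤ n → (m + 5 ≡ n) ⇔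
    ((G ≅ (K (n ∸ 4) ∨G E 4))
    ⊎ (G ≅ (K (n ∸ 4) ∨G (E 2 ∪ K 2)))
    ⊎ (G ≅ (K (n ∸ 4) ∨G (P 3 ∪ K 1)))
    ⊎ (G ≅ (K (n ∸ 4) ∨G (K 2 ∪ K 2)))
    ⊎ (G ≅ (K (n ∸ 4) ∨G P 4))
    ⊎ (G ≅ (K (n ∸ 4) ∨G (K 3 ∪ K 1)))
    ⊎ (G ≅ (K (n ∸ 4) ∨G C 4))
    ⊎ (G ≅ (K (n ∸ 5) ∨G C 5))
    ⊎ (G ≅ (K (n ∸ 5) ∨G (K 1 ∪ P 4)))
    ⊎ (G ≅ (K (n ∸ 5) ∨G Bull)))
  corank5 16≤n = mk⇔
    (λ m+5≡n → by-radius 5 m+5≡n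
      (λ { H noUniv form refl → order4 H form (proj₂ (classify₄ H noUniv)) })
      (λ H noUniv form → [ wrong-corank m+5≡n H noUniv form (λ ()) , order5 H form ]′ (classify₅ H noUniv))
      (λ 2≤ecc → contradiction (ℕ.≤-trans 16≤n (Radius≥2.order≤15 G conn mult 2≤ecc m+5≡n)) (ℕ.<-irrefl refl)))
    [ corank-≅ (E 4) 4<n refl refl
    , [ corank-≅ (E 2 ∪ K 2) 4<n refl refl
    , [ corank-≅ (P 3 ∪ K 1) 4<n refl refl
    , [ corank-≅ (K 2 ∪ K 2) 4<n refl refl
    , [ corank-≅ (P 4) 4<n refl refl
    , [ corank-≅ (K 3 ∪ K 1) 4<n refl refl
    , [ corank-≅ (C 4) 4<n refl refl
    -- The three null vectors have the form (-t, y) with (I + 2B)y = t1, B the complement, and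
    -- entries of y summing to t. Here t is 5, 1 and 3, and y is 1 at the first vertex.
    , [ corank-≅-singular (C 5) 5<n refl (lookup (ℤ.- + 5 ∷ 1ℤ ∷ 1ℤ ∷ 1ℤ ∷ 1ℤ ∷ 1ℤ ∷ [])) refl (zero , λ ())
    , [ corank-≅-singular (K 1 ∪ P 4) 5<n refl (lookup (ℤ.-1ℤ ∷ 1ℤ ∷ ℤ.-1ℤ ∷ 1ℤ ∷ 1ℤ ∷ ℤ.-1ℤ ∷ [])) refl (zero , λ ())
    , corank-≅-singular Bull 5<n refl (lookup (ℤ.- + 3 ∷ 1ℤ ∷ 1ℤ ∷ ℤ.-1ℤ ∷ 1ℤ ∷ 1ℤ ∷ [])) refl (zero , λ ())
    ]′ ]′ ]′ ]′ ]′ ]′ ]′ ]′ ]′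
    where
    4<n : 4 < n
    4<n = ℕ.≤-trans (ℕ.m≤m+n 5 11) 16≤n
    5<n : 1 ≤ n ∸ 5
    5<n = ℕ.m<n⇒0<n∸m (ℕ.≤-trans (ℕ.m≤m+n 6 10) 16≤n)
    order4 : ∀ {s} (H : Graph 4) → JoinForm G (suc s) H →
      Any (H ≅_) (E 4 ∷ (E 2 ∪ K 2) ∷ (P 3 ∪ K 1) ∷ (K 2 ∪ K 2) ∷ P 4 ∷ (K 3 ∪ K 1) ∷ C 4 ∷ []) → _
    order4 H form (here e)                                                 = inj₁ (joined H (E 4) form e)
    order4 H form (there (here e))                                         = inj₂ (inj₁ (joined H (E 2 ∪ K 2) form e))
    order4 H form (there (there (here e)))                                 = inj₂ (inj₂ (inj₁ (joined H (P 3 ∪ K 1) form e)))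
    order4 H form (there (there (there (here e))))                         = inj₂ (inj₂ (inj₂ (inj₁ (joined H (K 2 ∪ K 2) form e))))
    order4 H form (there (there (there (there (here e)))))                 = inj₂ (inj₂ (inj₂ (inj₂ (inj₁ (joined H (P 4) form e)))))
    order4 H form (there (there (there (there (there (here e))))))         = inj₂ (inj₂ (inj₂ (inj₂ (inj₂ (inj₁ (joined H (K 3 ∪ K 1) form e))))))
    order4 H form (there (there (there (there (there (there (here e))))))) = inj₂ (inj₂ (inj₂ (inj₂ (inj₂ (inj₂ (inj₁ (joined H (C 4) form e)))))))
    order5 : ∀ {s} (H : Graph 5) → JoinForm G (suc s) H → Any (H ≅_) (C 5 ∷ (K 1 ∪ P 4) ∷ Bull ∷ []) → _
    order5 H form (here e)                 = inj₂ (inj₂ (inj₂ (inj₂ (inj₂ (inj₂ (inj₂ (inj₁ (joined H (C 5) form e))))))))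
    order5 H form (there (here e))         = inj₂ (inj₂ (inj₂ (inj₂ (inj₂ (inj₂ (inj₂ (inj₂ (inj₁ (joined H (K 1 ∪ P 4) form e)))))))))
    order5 H form (there (there (here e))) = inj₂ (inj₂ (inj₂ (inj₂ (inj₂ (inj₂ (inj₂ (inj₂ (inj₂ (joined H Bull form e)))))))))

theorem1p1 : (n : ℕ) → 1 ≤ n → (G : Graph n) → Connected G →
    (m : ℕ) → HasEigMult (eccMatrix G) (- 1ℚ) m →
    ((m + 1 ≡ n) ⇔ (G ≅ K n))
    × (¬ (m + 2 ≡ n))
    × (4 ≤ n → ((m + 3 ≡ n) ⇔ ((G ≅ (K (n ∸ 2) ∨G E 2)) ⊎ (G ≅ P 4))))
    × (9 ≤ n → ((m + 4 ≡ n) ⇔ ((G ≅ (K (n ∸ 3) ∨G (K 2 ∪ K 1))) ⊎ (G ≅ (K (n ∸ 3) ∨G E 3)))))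
    × (16 ≤ n → ((m + 5 ≡ n) ⇔
    ((G ≅ (K (n ∸ 4) ∨G E 4))
    ⊎ (G ≅ (K (n ∸ 4) ∨G (E 2 ∪ K 2)))
    ⊎ (G ≅ (K (n ∸ 4) ∨G (P 3 ∪ K 1)))
    ⊎ (G ≅ (K (n ∸ 4) ∨G (K 2 ∪ K 2)))
    ⊎ (G ≅ (K (n ∸ 4) ∨G P 4))
    ⊎ (G ≅ (K (n ∸ 4) ∨G (K 3 ∪ K 1)))
    ⊎ (G ≅ (K (n ∸ 4) ∨G C 4))
    ⊎ (G ≅ (K (n ∸ 5) ∨G C 5))
    ⊎ (G ≅ (K (n ∸ 5) ∨G (K 1 ∪ P 4)))
    ⊎ (G ≅ (K (n ∸ 5) ∨G Bull)))))
theorem1p1 n 1≤n G conn m mult = corank1 , corank2 , corank3 , corank4 , corank5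
  where open Theorem 1≤n G conn mult
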